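{- Let $D$ be a division ring (finite or infinite), $I$ a set, and $\mathcal{F}$ a filter on $I$ which is not the intersection of finitely many $\mathrm{card}(D)^+$-complete ultrafilters. Then $$\dim_D\,(D^I/\mathcal{F})\ =\ \mathrm{card}(D^I/\mathcal{F}),$$ where $\dim_D$ can be taken to mean the dimension either as a right or as a left $D$-vector space.
   Context: A filter on $I$ is a set of subsets of $I$ containing $I$, closed under passing to larger subsets of $I$, and closed under pairwise intersections; it may be improper (equal to the set of all subsets of $I$). An ultrafilter is a maximal proper filter. A filter is $\kappa$-complete if it is closed under intersections of families of $<\kappa$ members. $\mathrm{card}(D)^+$ is the successor cardinal of $\mathrm{card}(D)$; when $D$ is finite, every ultrafilter is $\mathrm{card}(D)^+$-complete, so in that case the hypothesis simply says that $\mathcal{F}$ is not the intersection of finitely many ultrafilters. Convention: the intersection of the empty family of ultrafilters is the improper filter, and "finitely many" allows zero. $D^I/\mathcal{F}$ is the reduced power: the quotient of $D^I$ by the relation $(a_i)\sim(b_i)$ iff $\{i\mid a_i=b_i\}\in\mathcal{F}$, with its induced $D$-vector space structures. -}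

module Defs where

open import Algebra.Bundles using (Ring; CommutativeMonoid)
import Algebra.Definitions as AlgebraDefinitions
open import Algebra.Module.Bundles using (LeftModule; RightModule; Bimodule)
import Algebra.Properties.Monoid.Sum as MonoidSum
open import Axiom.ExcludedMiddle using (ExcludedMiddle)
open import Data.Bool.Base using (Bool; true; false)
open import Data.Bool.Properties using (_≟_)
open import Data.Fin.Base using (Fin)
open import Data.Nat.Base using (ℕ)
open import Data.Product.Base using (Σ; ∃; _×_; _,_; proj₁; proj₂)
open import Data.Unit.Polymorphic.Base using (⊤; tt)
open import Data.Vec.Functional using (Vector; zipWith)
open import Function.Base using (flip)
open import Function.Bundles using (Func; Injection; Bijection)
open import Function.Definitions using (Injective)
open import Level using (Level; Setω; _⊔_; suc; 0ℓ)
open import Relation.Binary.Bundles using (Setoid)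
open import Relation.Binary.Core using (REL; Rel)
import Relation.Binary.Construct.On as On
open import Relation.Binary.Definitions using (_Respectsˡ_; _Respectsʳ_)
open import Relation.Binary.PropositionalEquality
  using (_≡_; refl; setoid)
open import Relation.Nullary using (¬_; Dec; yes; no)
open import Relation.Unary using (Pred; _∈_; _⊆_; _∩_; _≐_; ⋂)

------------------------------------------------------------------------
-- The axiom of choice

-- Sets are setoids, so the choice function is required to respect the
-- equalities; without that requirement the axiom would be a triviality
-- of type theory.  In this form it also yields classical logic (see
-- `choice⇒em`), so it is the only addition needed to reason as in ZFC.

AxiomOfChoice : Setω
AxiomOfChoice =
  ∀ {a ℓ₁ b ℓ₂ r : Level} (A : Setoid a ℓ₁) (B : Setoid b ℓ₂) →
  let module A = Setoid A ; module B = Setoid B in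
  (R : REL A.Carrier B.Carrier r) →
  R Respectsˡ A._≈_ → R Respectsʳ B._≈_ →
  (∀ x → ∃ λ y → R x y) →
  Σ (Func A B) λ f → ∀ x → R x (Func.to f x)

-- Diaconescu's theorem: choose representatives for the equivalence
-- relation on Bool that identifies true and false exactly when P holds.

choice⇒em : AxiomOfChoice → ∀ {ℓ} → ExcludedMiddle ℓ
choice⇒em ac {ℓ} {P} = decide (Func.to f true ≟ Func.to f false)
  where
  _~_ : Rel Bool ℓ
  true  ~ true  = ⊤
  false ~ false = ⊤
  true  ~ false = P
  false ~ true  = P

  ~-refl : ∀ x → x ~ x
  ~-refl true  = tt
  ~-refl false = tt

  ~-sym : ∀ x y → x ~ y → y ~ x
  ~-sym true  true  p = p
  ~-sym true  false p = p
  ~-sym false true  p = p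
  ~-sym false false p = p

  ~-trans : ∀ x y z → x ~ y → y ~ z → x ~ z
  ~-trans true  true  z     p q = q
  ~-trans false false z     p q = q
  ~-trans true  false true  p q = tt
  ~-trans true  false false p q = p
  ~-trans false true  true  p q = p
  ~-trans false true  false p q = tt

  S : Setoid 0ℓ ℓ
  S = record
    { Carrier = Bool
    ; _≈_ = _~_
    ; isEquivalence = record
      { refl  = λ {x} → ~-refl x
      ; sym   = λ {x} {y} → ~-sym x y
      ; trans = λ {x} {y} {z} → ~-trans x y z
      }
    }

  choice : Σ (Func S (setoid Bool)) λ f → ∀ x → x ~ Func.to f x
  choice = ac S (setoid Bool) _~_
    (λ {z} {x} {y} x~y x~z → ~-trans y x z (~-sym x y x~y) x~z)
    (λ { refl p → p })
    (λ x → x , ~-refl x)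

  f : Func S (setoid Bool)
  f = proj₁ choice

  decide : Dec (Func.to f true ≡ Func.to f false) →
           Dec P
  decide (no  ne) = no λ p → ne (Func.cong f p)
  decide (yes eq) = yes (join (Func.to f true) (Func.to f false) eq
                              (proj₂ choice true) (proj₂ choice false))
    where
    join : ∀ x y → x ≡ y → true ~ x → false ~ y → P
    join true  .true  refl p q = q
    join false .false refl p q = p

------------------------------------------------------------------------
-- Cardinalities

-- The cardinal of a setoid is represented by the setoid itself.

infix 4 _≋_ _≼_ _≺_

_≋_ : ∀ {a ℓ₁ b ℓ₂} → Setoid a ℓ₁ → Setoid b ℓ₂ → Set (a ⊔ ℓ₁ ⊔ b ⊔ ℓ₂)
A ≋ B = Bijection A B

_≼_ : ∀ {a ℓ₁ b ℓ₂} → Setoid a ℓ₁ → Setoid b ℓ₂ → Set (a ⊔ ℓ₁ ⊔ b ⊔ ℓ₂)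
A ≼ B = Injection A B

_≺_ : ∀ {a ℓ₁ b ℓ₂} → Setoid a ℓ₁ → Setoid b ℓ₂ → Set (a ⊔ ℓ₁ ⊔ b ⊔ ℓ₂)
A ≺ B = A ≼ B × ¬ (B ≼ A)

IsSuccessorCardinal : ∀ {ℓ} → Setoid ℓ ℓ → Setoid ℓ ℓ → Set (suc ℓ)
IsSuccessorCardinal {ℓ} κ A = A ≺ κ × (∀ (B : Setoid ℓ ℓ) → A ≺ B → κ ≼ B)

subsetoid : ∀ {a ℓ p} (A : Setoid a ℓ) → Pred (Setoid.Carrier A) p →
            Setoid (a ⊔ p) ℓ
subsetoid A P = On.setoid {B = Σ (Setoid.Carrier A) P} A proj₁

------------------------------------------------------------------------
-- Filters

-- A collection of subsets of I; the subsets, the collection and I all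
-- live in one universe.  Classically this loses no collections, since
-- every proposition is equivalent to one in the lowest universe.

Collection : ∀ {ℓ} → Set ℓ → Set (suc ℓ)
Collection {ℓ} I = Pred (Pred I ℓ) ℓ

module _ {ℓ : Level} {I : Set ℓ} where

  record IsFilter (F : Collection I) : Set (suc ℓ) where
    field
      whole    : (λ _ → ⊤) ∈ F
      upward   : ∀ {A B : Pred I ℓ} → A ⊆ B → A ∈ F → B ∈ F
      ∩-closed : ∀ {A B : Pred I ℓ} → A ∈ F → B ∈ F → A ∩ B ∈ F

  Improper : Collection I → Set (suc ℓ)
  Improper F = ∀ A → A ∈ F

  record IsProperFilter (F : Collection I) : Set (suc ℓ) where
    field
      isFilter : IsFilter F
      proper   : ¬ Improper F

  record IsUltrafilter (F : Collection I) : Set (suc ℓ) where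
    field
      isProperFilter : IsProperFilter F
      maximal        : ∀ (G : Collection I) → IsProperFilter G → F ⊆ G → G ⊆ F

  IsComplete : Setoid ℓ ℓ → Collection I → Set (suc ℓ)
  IsComplete κ F = ∀ (J : Set ℓ) → setoid J ≺ κ → (A : J → Pred I ℓ) →
                   (∀ j → A j ∈ F) → ⋂ J A ∈ F

  -- For n = 0 the intersection is the improper filter.

  IsFiniteIntersectionOfCompleteUltrafilters :
    Setoid ℓ ℓ → Collection I → Set (suc ℓ)
  IsFiniteIntersectionOfCompleteUltrafilters κ F =
    Σ ℕ λ n → Σ (Fin n → Collection I) λ 𝒰 →
    (∀ k → IsUltrafilter (𝒰 k) × IsComplete κ (𝒰 k)) × F ≐ ⋂ (Fin n) 𝒰

------------------------------------------------------------------------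
-- Division rings and dimension

record IsDivisionRing {c ℓ} (D : Ring c ℓ) : Set (c ⊔ ℓ) where
  open Ring D
  open AlgebraDefinitions _≈_ using (Invertible)
  field
    1≉0     : ¬ (1# ≈ 0#)
    inverse : ∀ x → ¬ (x ≈ 0#) → Invertible 1# _*_ x

-- Left and right vector spaces at once: `d · v` stands for the scalar
-- multiple of v by d, on whichever side the scalars act.

module Basis {ℓ : Level} (D : Ring ℓ ℓ) (V : CommutativeMonoid ℓ ℓ)
  (_·_ : Ring.Carrier D → CommutativeMonoid.Carrier V →
         CommutativeMonoid.Carrier V)
  where

  private
    module D = Ring D
    module V = CommutativeMonoid V

  combination : ∀ {n} → Vector D.Carrier n → Vector V.Carrier n → V.Carrier
  combination d v = MonoidSum.sum V.monoid (zipWith _·_ d v)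

  LinearlyIndependent : Pred V.Carrier ℓ → Set ℓ
  LinearlyIndependent B =
    ∀ n (d : Vector D.Carrier n) (v : Vector V.Carrier n) →
    (∀ k → v k ∈ B) → Injective _≡_ V._≈_ v →
    combination d v V.≈ V.ε → ∀ k → d k D.≈ D.0#

  Spanning : Pred V.Carrier ℓ → Set ℓ
  Spanning B =
    ∀ x → Σ ℕ λ n → Σ (Vector D.Carrier n) λ d → Σ (Vector V.Carrier n) λ v →
    (∀ k → v k ∈ B) × x V.≈ combination d v

  IsBasis : Pred V.Carrier ℓ → Set ℓ
  IsBasis B = LinearlyIndependent B × Spanning B

  HasDimension : Setoid ℓ ℓ → Set (suc ℓ)
  HasDimension κ =
    ∃ IsBasis × (∀ B → IsBasis B → subsetoid V.setoid B ≋ κ)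

HasLeftDimension : ∀ {ℓ} {D : Ring ℓ ℓ} → LeftModule D ℓ ℓ → Setoid ℓ ℓ →
                   Set (suc ℓ)
HasLeftDimension {D = D} V = Basis.HasDimension D +ᴹ-commutativeMonoid _*ₗ_
  where open LeftModule V

HasRightDimension : ∀ {ℓ} {D : Ring ℓ ℓ} → RightModule D ℓ ℓ → Setoid ℓ ℓ →
                    Set (suc ℓ)
HasRightDimension {D = D} V =
  Basis.HasDimension D +ᴹ-commutativeMonoid (flip _*ᵣ_)
  where open RightModule V

------------------------------------------------------------------------
-- The reduced power

module ReducedPower {ℓ : Level} (D : Ring ℓ ℓ) (I : Set ℓ)
  (F : Collection I) (isFilter : IsFilter F) where

  private
    module D = Ring D
  open IsFilter isFilter

  infix 4 _∼_

  _∼_ : Rel (I → D.Carrier) ℓ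
  a ∼ b = (λ i → a i D.≈ b i) ∈ F

  private
    everywhere : ∀ {A : Pred I ℓ} → (∀ i → A i) → A ∈ F
    everywhere p = upward (λ {i} _ → p i) whole

    lift₁ : ∀ {A B : Pred I ℓ} → (∀ i → A i → B i) → A ∈ F → B ∈ F
    lift₁ f = upward (λ {i} → f i)

    lift₂ : ∀ {A B C : Pred I ℓ} → (∀ i → A i → B i → C i) →
            A ∈ F → B ∈ F → C ∈ F
    lift₂ f p q = upward (λ {i} (x , y) → f i x y) (∩-closed p q)

  bimodule : Bimodule D D ℓ ℓ
  bimodule = record
    { Carrierᴹ = I → D.Carrier
    ; _≈ᴹ_ = _∼_
    ; _+ᴹ_ = λ a b i → a i D.+ b i
    ; _*ₗ_ = λ d a i → d D.* a i
    ; _*ᵣ_ = λ a d i → a i D.* d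
    ; 0ᴹ   = λ _ → D.0#
    ; -ᴹ_  = λ a i → D.- a i
    ; isBimodule = record
      { isBisemimodule = record
        { +ᴹ-isCommutativeMonoid = record
          { isMonoid = record
            { isSemigroup = record
              { isMagma = record
                { isEquivalence = record
                  { refl  = everywhere λ _ → D.refl
                  ; sym   = lift₁ λ _ → D.sym
                  ; trans = lift₂ λ _ → D.trans
                  }
                ; ∙-cong = lift₂ λ _ → D.+-cong
                }
              ; assoc = λ a b c → everywhere λ i → D.+-assoc (a i) (b i) (c i)
              }
            ; identity = (λ a → everywhere λ i → D.+-identityˡ (a i))
                       , (λ a → everywhere λ i → D.+-identityʳ (a i))
            }
          ; comm = λ a b → everywhere λ i → D.+-comm (a i) (b i)
          }
        ; isPreleftSemimodule = record
          { *ₗ-cong      = λ d≈e → lift₁ λ _ → D.*-cong d≈e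
          ; *ₗ-zeroˡ     = λ a → everywhere λ i → D.zeroˡ (a i)
          ; *ₗ-distribʳ  = λ a d e → everywhere λ i → D.distribʳ (a i) d e
          ; *ₗ-identityˡ = λ a → everywhere λ i → D.*-identityˡ (a i)
          ; *ₗ-assoc     = λ d e a → everywhere λ i → D.*-assoc d e (a i)
          ; *ₗ-zeroʳ     = λ d → everywhere λ _ → D.zeroʳ d
          ; *ₗ-distribˡ  = λ d a b → everywhere λ i → D.distribˡ d (a i) (b i)
          }
        ; isPrerightSemimodule = record
          { *ᵣ-cong      = λ a∼b d≈e → lift₁ (λ _ p → D.*-cong p d≈e) a∼b
          ; *ᵣ-zeroʳ     = λ a → everywhere λ i → D.zeroʳ (a i)
          ; *ᵣ-distribˡ  = λ a d e → everywhere λ i → D.distribˡ (a i) d e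
          ; *ᵣ-identityʳ = λ a → everywhere λ i → D.*-identityʳ (a i)
          ; *ᵣ-assoc     = λ a d e → everywhere λ i → D.*-assoc (a i) d e
          ; *ᵣ-zeroˡ     = λ d → everywhere λ _ → D.zeroˡ d
          ; *ᵣ-distribʳ  = λ d a b → everywhere λ i → D.distribʳ d (a i) (b i)
          }
        ; *ₗ-*ᵣ-assoc = λ d a e → everywhere λ i → D.*-assoc d (a i) e
        }
      ; -ᴹ‿cong    = lift₁ λ _ → D.-‿cong
      ; -ᴹ‿inverse = (λ a → everywhere λ i → D.-‿inverseˡ (a i))
                   , (λ a → everywhere λ i → D.-‿inverseʳ (a i))
      }
    }

  open Bimodule bimodule public
    using (leftModule; rightModule)
    renaming (≈ᴹ-setoid to carrierSetoid)

{-# OPTIONS --safe #-}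
module Submission where

-- Let V = D^I/F and let B be a basis of V.  Since every vector is coded by a
-- finite list over D × B, it suffices to show card D ≤ card B and B infinite.
--
-- If F is not a finite intersection of ultrafilters, then there are infinitely
-- many disjoint sets whose complements are not in F; if F is not
-- card(D)⁺-complete, then some A_d ∈ F, indexed by a subset of D, have an
-- intersection outside of F, and one sends i to a d with i ∉ A_d.  Either way
-- there is f : I → D such that every member of F has an infinite image.
--
-- Suppose card B < card D.  The functions g ∘ f form a subspace of V, and its
-- intersection with the span of a finite part of B is generated by finitely many
-- functions c ∘ f.  Now construct g : D → D by recursion along a well-order of D
-- with small initial segments.  Infinitely many columns (c₁(y), …, cₘ(y))
-- always include one that is a right-linear combination of earlier ones, and
-- g(y) is chosen to violate the same relation, for all of the fewer than card D
-- many choices of a finite part of B and of finitely many arguments below y.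
-- Then g is not a left-linear combination of c₁, …, cₘ on any infinite set.  For
-- countable D the last count fails, but B is finite and g is obtained by
-- diagonalisation.
--
-- For finite D the same elimination with the indices of the disjoint sets in
-- place of D shows that the indicator of one of them is not in the span of B.

open import Algebra.Bundles using (CommutativeMonoid; Ring)
import Algebra.Construct.Flip.Op as Op
open import Algebra.Module.Bundles using (LeftModule)
import Algebra.Module.Properties.LeftModule as LeftModuleProperties
import Algebra.Properties.CommutativeMonoid.Sum as MonoidSum
open import Algebra.Properties.CommutativeSemigroup using (interchange)
import Algebra.Properties.Ring as RingProperties
open import Data.Bool.Base using (Bool; false; true)
open import Data.Empty using (⊥; ⊥-elim)
import Data.Empty.Polymorphic as Empty
open import Data.Fin.Base using (Fin; fromℕ<; punchIn; suc; toℕ; zero)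
import Data.Fin.Properties as Fin
open import Data.List.Base
  using (List; []; _++_; _∷_; cartesianProduct; length; lookup; map; tabulate; upTo)
open import Data.List.Membership.Propositional using () renaming (_∈_ to _∈ˡ_)
open import Data.List.Membership.Propositional.Properties
  using (∈-++⁺ʳ; ∈-++⁺ˡ; ∈-cartesianProduct⁺; ∈-lookup; ∈-map⁺; ∈-upTo⁺)
open import Data.List.Properties using (length-map; map-injective)
open import Data.List.Relation.Binary.Pointwise using (Pointwise; []; _∷_)
open import Data.List.Relation.Unary.All as All using (All; []; _∷_)
import Data.List.Relation.Unary.All.Properties as All
open import Data.List.Relation.Unary.Any using (here; index; there)
open import Data.List.Relation.Unary.Any.Properties using (lookup-index)
open import Data.Maybe.Base using (Maybe; just; nothing)
open import Data.Nat.Base as ℕ using (suc; s≤s; zero; ℕ)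
import Data.Nat.Induction as ℕ
import Data.Nat.Properties as ℕ
open import Data.Product.Base using (_,_; _×_; proj₁; proj₂; Σ; ∃)
open import Data.Product.Relation.Binary.Lex.Strict using (×-Lex; ×-wellFounded)
open import Data.Sum.Base as Sum using ([_,_]′; _⊎_; inj₁; inj₂)
open import Data.Unit.Polymorphic.Base using (tt; ⊤)
open import Data.Vec.Functional as Vector using (Vector; removeAt; zipWith)
open import Defs
open import Function.Base using (_on_; _∘_; case_of_; id)
open import Function.Bundles using (Bijection; Func; Injection; _↣_; mk↣)
open import Function.Construct.Composition using (_↣-∘_)
open import Function.Construct.Identity using (↣-id)
import Function.Construct.Symmetry as Symmetry
open import Induction.WellFounded
  using (Acc; module All; module FixPoint; module Subrelation; WellFounded; WfRec; acc; wf⇒asym)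
open import Level using (0ℓ; Level; _⊔_) renaming (suc to lsuc)
open import Relation.Binary.Bundles using (Setoid)
import Relation.Binary.Construct.On as On
open import Relation.Binary.Core using (Rel)
open import Relation.Binary.Definitions using (Irrelevant; tri<; tri>; tri≈)
open import Relation.Binary.PropositionalEquality
  using (_≗_; _≡_; _≢_; cong; cong₂; refl; setoid; subst; sym; trans)
open import Relation.Binary.PropositionalEquality.WithK using (≡-irrelevant)
import Relation.Binary.Reasoning.Setoid as SetoidReasoning
open import Relation.Nullary using (Dec; contradiction; does; no; yes; ¬_)
open import Relation.Unary using (Pred; _∈_; _∩_; _⊆_; ⋂)

private
  variable
    a b c p : Level
    X Y Z : Set a

-- Well-orders, initial segments and finite covers.

open Injection using (to; injective)

-- Irrelevance of `_<_` makes an element of `Seg x` determined by its first component, so that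
-- segments embed into `X`. Transitivity is not a field because it follows from the others.
record WellOrder (X : Set a) : Set (a ⊔ lsuc 0ℓ) where
  infix 4 _<_
  field
    _<_        : Rel X 0ℓ
    irrelevant : Irrelevant _<_
    total      : ∀ {x y} → x ≢ y → x < y ⊎ y < x
    wf         : WellFounded _<_

  asym : ∀ {x y} → x < y → ¬ (y < x)
  asym = wf⇒asym wf

  irrefl : ∀ {x} → ¬ (x < x)
  irrefl x<x = asym x<x x<x

  private
    -- A cycle of three elements can be rotated so that its base point descends, again and again,
    -- which accessibility forbids.
    acyclic : ∀ {x} → Acc _<_ x → ∀ {y z} → x < y → y < z → ¬ (z < x)
    acyclic (acc rs) x<y y<z z<x = acyclic (rs z<x) z<x x<y y<z

  <-trans : ∀ {x y z} → x < y → y < z → x < z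
  <-trans x<y y<z =
    [ id , (λ z<x → contradiction z<x (acyclic (wf _) x<y y<z)) ]′
      (total λ { refl → asym x<y y<z })

  <-≮-trans : ∀ {x y z} → x < y → ¬ (z < y) → x < z
  <-≮-trans x<y z≮y =
    [ id , (λ z<x → contradiction (<-trans z<x x<y) z≮y) ]′
      (total λ { refl → z≮y x<y })

  Seg : X → Set _
  Seg x = ∃ λ y → y < x

  Seg-≡ : ∀ {x} {s t : Seg x} → proj₁ s ≡ proj₁ t → s ≡ t
  Seg-≡ {s = y , p} {.y , q} refl = cong (y ,_) (irrelevant p q)

  Seg↣ : ∀ x → Seg x ↣ X
  Seg↣ _ = mk↣ {to = proj₁} Seg-≡

  Seg-mono : ∀ {x y} → x < y → Seg x ↣ Seg y
  Seg-mono x<y = mk↣ {to = λ (z , z<x) → z , <-trans z<x x<y} (Seg-≡ ∘ cong proj₁)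

ℕ-wellOrder : WellOrder ℕ
ℕ-wellOrder = record
  { _<_        = ℕ._<_
  ; irrelevant = ℕ.<-irrelevant
  ; total      = λ {m} {n} m≢n → case ℕ.<-cmp m n of λ
    { (tri< m<n _ _) → inj₁ m<n
    ; (tri≈ _ m≡n _) → contradiction m≡n m≢n
    ; (tri> _ _ n<m) → inj₂ n<m }
  ; wf         = ℕ.<-wellFounded
  }

pullback : Y ↣ X → WellOrder X → WellOrder Y
pullback f W = record
  { _<_        = _<_ on to f
  ; irrelevant = irrelevant
  ; total      = λ x≢y → total (x≢y ∘ injective f)
  ; wf         = On.wellFounded (to f) wf
  }
  where open WellOrder W

Seg-pullback : (f : Y ↣ X) (W : WellOrder X) (y : Y) →
               WellOrder.Seg (pullback f W) y ↣ WellOrder.Seg W (to f y)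
Seg-pullback f W y =
  mk↣ {to = λ (z , z<y) → to f z , z<y}
      (WellOrder.Seg-≡ (pullback f W) ∘ injective f ∘ cong proj₁)

_×↣_ : {X′ : Set a} {Y′ : Set b} → X ↣ Y → X′ ↣ Y′ → (X × X′) ↣ (Y × Y′)
f ×↣ g = mk↣ {to = λ (x , y) → to f x , to g y}
  λ eq → cong₂ _,_ (injective f (cong proj₁ eq)) (injective g (cong proj₂ eq))

Covers : List X → Set _
Covers l = ∀ x → x ∈ˡ l

⊆list⇒↣Fin : (f : X ↣ Y) (l : List Y) → (∀ x → to f x ∈ˡ l) → X ↣ Fin (length l)
⊆list⇒↣Fin f l mem = mk↣ {to = index ∘ mem} λ {x} {y} eq → injective f
  (trans (lookup-index (mem x)) (trans (cong (lookup l) eq) (sym (lookup-index (mem y)))))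

covers⇒↣Fin : (l : List X) → Covers l → X ↣ Fin (length l)
covers⇒↣Fin = ⊆list⇒↣Fin (↣-id _)

ℕ↣̸Fin : ∀ {n} → ¬ (ℕ ↣ Fin n)
ℕ↣̸Fin f = Fin.ℕ→Fin-notInjective (to f) (injective f)

Infinite : {X : Set a} → Pred X p → Set _
Infinite P = ∀ l → ∃ λ x → P x × ¬ (x ∈ˡ l)

-- Classical logic from choice.

module Choice (ac : AxiomOfChoice) where

  abstract
    em : (P : Set a) → Dec P
    em P = choice⇒em ac

  abstract
    dne : {P : Set a} → ¬ ¬ P → P
    dne {P = P} ¬¬p with em P
    ... | yes p = p
    ... | no ¬p = contradiction ¬p ¬¬p

    ¬∀⇒∃¬ : {P : X → Set b} → ¬ (∀ x → P x) → ∃ λ x → ¬ P x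
    ¬∀⇒∃¬ ¬∀ = dne λ ¬∃ → ¬∀ λ x → dne λ ¬p → ¬∃ (x , ¬p)

  ⟦_⟧ : Set a → Bool
  ⟦ P ⟧ = does (em P)

  -- This replaces a proposition of any universe by a proof-irrelevant one in the lowest universe,
  -- as `WellOrder` demands of its order.
  Holds : Set a → Set
  Holds P = ⟦ P ⟧ ≡ true

  holds : {P : Set a} → P → Holds P
  holds {P = P} p with em P
  ... | yes _ = refl
  ... | no ¬p = contradiction p ¬p

  holds⁻¹ : {P : Set a} → Holds P → P
  holds⁻¹ {P = P} h with em P
  holds⁻¹ {P = P} h  | yes p = p
  holds⁻¹ {P = P} () | no ¬p

  abstract
    section : (f : X → Y) → (∀ y → ∃ λ x → f x ≡ y) → Y ↣ X
    section f surj = mk↣ {to = proj₁ ∘ surj} λ {y} {y′} eq →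
      trans (sym (proj₂ (surj y))) (trans (cong f eq) (proj₂ (surj y′)))

  least : (W : WellOrder X) → let open WellOrder W in {P : X → Set b} →
          ∃ P → ∃ λ x → P x × (∀ y → y < x → ¬ P y)
  least W {P} (x , p) = go (wf x) p
    where
    open WellOrder W
    go : ∀ {x} → Acc _<_ x → P x → ∃ λ x → P x × (∀ y → y < x → ¬ P y)
    go {x} (acc rs) p with em (∃ λ y → y < x × P y)
    ... | yes (y , y<x , q) = go (rs y<x) q
    ... | no  none          = x , p , λ y y<x q → none (y , y<x , q)

  -- The well-ordering theorem

  module _ {X : Set a} (x₀ : X) where

    private
      Subset : Set a
      Subset = X → Bool

      infix 4 _∈ᵇ_ _∉ᵇ_ _⊆ᵇ_
      _∈ᵇ_ _∉ᵇ_ : X → Subset → Set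
      x ∈ᵇ P = P x ≡ true
      x ∉ᵇ P = ¬ x ∈ᵇ P

      _⊆ᵇ_ : Subset → Subset → Set a
      P ⊆ᵇ Q = ∀ x → x ∈ᵇ P → x ∈ᵇ Q

      Full : Subset → Set a
      Full P = ∀ x → x ∈ᵇ P

      abstract
        -- Respecting pointwise equality is essential: stages that list the same elements must
        -- choose the same next one.
        choice : Σ (Func (record { Carrier = Subset ; _≈_ = _≗_
                                 ; isEquivalence = record
                                   { refl  = λ _ → refl
                                   ; sym   = λ p x → sym (p x)
                                   ; trans = λ p q x → trans (p x) (q x) } })
                         (setoid X))
                   λ f → ∀ P → ¬ Full P → Func.to f P ∉ᵇ P
        choice = ac _ _ (λ P x → ¬ Full P → x ∉ᵇ P)
          (λ P≗Q r ¬full x∈Q → r (λ full → ¬full λ y → trans (sym (P≗Q y)) (full y))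
                                 (trans (P≗Q _) x∈Q))
          (λ { refl r → r })
          λ P → case em (Full P) of λ
            { (yes full) → x₀ , λ ¬full → contradiction full ¬full
            ; (no ¬full) → proj₁ (¬∀⇒∃¬ ¬full) , λ _ → proj₂ (¬∀⇒∃¬ ¬full) }

      next : Subset → X
      next = Func.to (proj₁ choice)

      ⊆-antisym⇒next : ∀ {P Q} → P ⊆ᵇ Q → Q ⊆ᵇ P → next P ≡ next Q
      ⊆-antisym⇒next {P} {Q} p q = Func.cong (proj₁ choice) λ x → eq x (P x) (Q x) refl refl
        where
        eq : ∀ x s t → P x ≡ s → Q x ≡ t → s ≡ t
        eq x true  true  _ _ = refl
        eq x false false _ _ = refl
        eq x true  false r s = trans (sym (p x r)) s
        eq x false true  r s = trans (sym r) (q x s)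

      -- Trees serve as ordinals: only the elements listed before a tree matter, so the trees
      -- themselves carry no order. Index types as large as `X` allow one ordinal above the stages
      -- of all elements of `X`.
      data Ord : Set (lsuc a) where
        sup : (A : Set a) → (A → Ord) → Ord

      -- The elements listed at the stages before a given ordinal when
      -- every stage lists the choice among what is still missing.
      before : Ord → Subset
      before (sup A h) x = ⟦ (∃ λ i → x ∈ᵇ before (h i) ⊎ x ≡ next (before (h i))) ⟧

      Extends : Subset → Subset → Set a
      Extends P Q = P ⊆ᵇ Q × next P ∈ᵇ Q

      -- For the sets listed before two ordinals, the alternatives play the part of α ≤ β and β < α.
      Comparable : Subset → Subset → Set a
      Comparable P Q = P ⊆ᵇ Q ⊎ Extends Q P

      before-⊆ : ∀ {A h} i → before (h i) ⊆ᵇ before (sup A h)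
      before-⊆ i x p = holds (i , inj₁ p)

      before-next : ∀ {A h} i → next (before (h i)) ∈ᵇ before (sup A h)
      before-next i = holds (i , inj₂ refl)

      -- Equal stages choose the same next element, so if `β` is not overtaken by `sup A h`, each
      -- `h i` stays inside `β` together with its choice. This uses both comparisons of `h i` with
      -- `β`, whence the conjunction.
      comparable : ∀ α β → Comparable (before α) (before β) × Comparable (before β) (before α)
      comparable (sup A h) (sup B k) =
        half A h (sup B k) (λ i → comparable (h i) (sup B k)) ,
        half B k (sup A h) (λ j → let p , q = comparable (sup A h) (k j) in q , p)
        where
        half : ∀ A h β →
               (∀ i → Comparable (before (h i)) (before β) × Comparable (before β) (before (h i))) →
               Comparable (before (sup A h)) (before β)
        half A h β ih with em (∃ λ i → Extends (before β) (before (sup A h)))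
        ... | yes (_ , e) = inj₂ e
        ... | no none = inj₁ λ x x∈ → sub x (holds⁻¹ x∈)
          where
          sub : ∀ x → (∃ λ i → x ∈ᵇ before (h i) ⊎ x ≡ next (before (h i))) → x ∈ᵇ before β
          sub x (i , r) with ih i
          ... | inj₂ (p , q) , _ = ⊥-elim (none (i , (λ y y∈ → before-⊆ {h = h} i y (p y y∈)) , before-⊆ {h = h} i _ q))
          ... | inj₁ p , inj₂ (_ , q) = [ p x , (λ { refl → q }) ]′ r
          ... | inj₁ p , inj₁ q = ⊥-elim (none (i , (λ y y∈ → before-⊆ {h = h} i y (q y y∈)) ,
                  subst (_∈ᵇ before (sup A h)) (⊆-antisym⇒next p q) (before-next {h = h} i)))

      StageOf : X → Ord → Set a
      StageOf x α = x ∉ᵇ before α × x ≡ next (before α)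

      stageOf-∈ : ∀ α x → x ∈ᵇ before α → ∃ (StageOf x)
      stageOf-∈ (sup A h) x x∈ with holds⁻¹ {P = ∃ λ i → x ∈ᵇ before (h i) ⊎ x ≡ next (before (h i))} x∈
      ... | i , inj₁ p = stageOf-∈ (h i) x p
      ... | i , inj₂ p with em (x ∈ᵇ before (h i))
      ...   | yes q = stageOf-∈ (h i) x q
      ...   | no  q = h i , q , p

      -- If `x` were never listed, the ordinal `α*` above all stages would not be full, so its next
      -- element would be missing from it; but that element is listed one step later, hence already
      -- before `α*`.
      listed : ∀ x → ∃ λ α → x ∈ᵇ before α
      listed x = dne λ ¬l → proj₂ choice (before α*) (λ full → ¬l (α* , full x)) next∈
        where
        stage : X → Ord
        stage y with em (∃ λ α → y ∈ᵇ before α)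
        ... | yes (α , _) = α
        ... | no  _       = sup Empty.⊥ Empty.⊥-elim

        ∈-stage : ∀ y α → y ∈ᵇ before α → y ∈ᵇ before (stage y)
        ∈-stage y α y∈ with em (∃ λ α → y ∈ᵇ before α)
        ... | yes (_ , p) = p
        ... | no  none    = contradiction (α , y∈) none

        α* : Ord
        α* = sup X stage

        next∈ : next (before α*) ∈ᵇ before α*
        next∈ = before-⊆ {h = stage} y y
          -- A constant family over `X`, which contains `x`, is the successor of `α*`.
          (∈-stage y (sup X λ _ → α*) (before-next {h = λ _ → α*} x))
          where
          y : X
          y = next (before α*)

      abstract
        stage : ∀ x → ∃ (StageOf x)
        stage x = let α , p = listed x in stageOf-∈ α x p

      at : X → Subset
      at x = before (proj₁ (stage x))

      at-∉ : ∀ x → x ∉ᵇ at x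
      at-∉ x = proj₁ (proj₂ (stage x))

      at-next : ∀ x → x ≡ next (at x)
      at-next x = proj₂ (proj₂ (stage x))

      _≺′_ : Rel X 0ℓ
      x ≺′ y = x ∈ᵇ at y

      ≺-total : ∀ {x y} → x ≢ y → x ≺′ y ⊎ y ≺′ x
      ≺-total {x} {y} x≢y with comparable (proj₁ (stage x)) (proj₁ (stage y))
      ... | inj₂ (_ , p) , _ = inj₂ (subst (_∈ᵇ at x) (sym (at-next y)) p)
      ... | _ , inj₂ (_ , p) = inj₁ (subst (_∈ᵇ at y) (sym (at-next x)) p)
      ... | inj₁ p , inj₁ q  = contradiction
              (trans (at-next x) (trans (⊆-antisym⇒next p q) (sym (at-next y)))) x≢y

      ≺-acc : ∀ α x → x ∈ᵇ before α → Acc _≺′_ x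
      ≺-acc (sup A h) x x∈ with holds⁻¹ {P = ∃ λ i → x ∈ᵇ before (h i) ⊎ x ≡ next (before (h i))} x∈
      ... | i , inj₁ p = ≺-acc (h i) x p
      ... | i , inj₂ refl = acc λ {y} y≺x → ≺-acc (h i) y (earlier y y≺x)
        where
        -- Otherwise `at x` would contain the element chosen after `before (h i)`, which is `x`
        -- itself.
        earlier : at x ⊆ᵇ before (h i)
        earlier with proj₁ (comparable (proj₁ (stage x)) (h i))
        ... | inj₁ p = p
        ... | inj₂ (_ , q) = contradiction q (at-∉ x)

    wellOrder₀ : WellOrder X
    wellOrder₀ = record
      { _<_        = _≺′_
      ; irrelevant = ≡-irrelevant
      ; total      = ≺-total
      ; wf         = λ x → let α , p = listed x in ≺-acc α x p
      }

  abstract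
    wellOrder : (X : Set a) → WellOrder X
    wellOrder X with em X
    ... | yes x = wellOrder₀ x
    ... | no ¬x = record
      { _<_        = λ _ _ → ⊥
      ; irrelevant = λ ()
      ; total      = λ {x} → contradiction x ¬x
      ; wf         = λ x → contradiction x ¬x
      }

  -- Recursion along well-orders and comparison of cardinals.

  abstract
    -- The choice of a value respects pointwise equality of `g`, which yields the unfolding equation
    -- of well-founded recursion. The values below `y` are extended by the default `x₀`, and `resp`
    -- makes the extension harmless.
    recursion : (W : WellOrder Y) → let open WellOrder W in
      (Ok : Y → (Y → X) → X → Set c) →
      (∀ y {g g′ x} → (∀ z → z < y → g z ≡ g′ z) → Ok y g x → Ok y g′ x) →
      X → (∀ y g → ∃ (Ok y g)) →
      ∃ λ g → ∀ y → Ok y g (g y)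
    recursion {Y = Y} {X = X} W Ok resp x₀ ok = g , λ y →
      resp y (restrict-≡ y) (subst (Ok y _) (sym unfold-wfRec) (proj₂ pick (y , restrict y)))
      where
      open WellOrder W

      pick : Σ (Func (record { Carrier = Y × (Y → X)
                             ; _≈_ = λ (y , h) (y′ , h′) → y ≡ y′ × h ≗ h′
                             ; isEquivalence = record
                               { refl  = refl , λ _ → refl
                               ; sym   = λ (p , q) → sym p , λ x → sym (q x)
                               ; trans = λ (p , q) (p′ , q′) → trans p p′ , λ x → trans (q x) (q′ x) } })
                     (setoid X))
               λ f → ∀ p → Ok (proj₁ p) (proj₂ p) (Func.to f p)
      pick = ac _ _ (λ (y , h) → Ok y h)
        (λ { (refl , h≗h′) → resp _ λ z _ → h≗h′ z })
        (λ { refl r → r })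
        λ (y , h) → ok y h

      extend : ∀ y → WfRec _<_ (λ _ → X) y → Y → X
      extend y ih z with em (z < y)
      ... | yes z<y = ih z<y
      ... | no  _   = x₀

      step : ∀ y → WfRec _<_ (λ _ → X) y → X
      step y ih = Func.to (proj₁ pick) (y , extend y ih)

      step-cong : ∀ y {ih ih′ : WfRec _<_ (λ _ → X) y} →
                  (∀ {z} z<y → ih {z} z<y ≡ ih′ z<y) → step y ih ≡ step y ih′
      step-cong y {ih} {ih′} eq = Func.cong (proj₁ pick) (refl , extend-cong)
        where
        extend-cong : extend y ih ≗ extend y ih′
        extend-cong z with em (z < y)
        ... | yes z<y = eq z<y
        ... | no  _   = refl

      open FixPoint wf (λ _ → X) step step-cong using (unfold-wfRec)

      g : Y → X
      g = All.wfRec wf _ (λ _ → X) step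

      restrict : Y → Y → X
      restrict y = extend y (λ {z} _ → g z)

      restrict-≡ : ∀ y z → z < y → restrict y z ≡ g z
      restrict-≡ y z z<y with em (z < y)
      ... | yes _  = refl
      ... | no z≮y = contradiction z<y z≮y

  abstract
    greedy : (W : WellOrder Y) → let open WellOrder W in X →
             (∀ y (g : Y → X) → ∃ λ x → ∀ z → z < y → g z ≢ x) → Y ↣ X
    greedy {Y = Y} {X = X} W x₀ avoid = mk↣ {to = g} inj
      where
      open WellOrder W
      r : ∃ λ (g : Y → X) → ∀ y z → z < y → g z ≢ g y
      r = recursion W (λ y g x → ∀ z → z < y → g z ≢ x)
            (λ y eq ok z z<y p → ok z z<y (trans (eq z z<y) p)) x₀ avoid
      g : Y → X
      g = proj₁ r

      inj : ∀ {y z} → g y ≡ g z → y ≡ z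
      inj {y} {z} eq = dne λ y≢z →
        [ (λ y<z → proj₂ r z y y<z eq) , (λ z<y → proj₂ r y z z<y (sym eq)) ]′ (total y≢z)

  -- Were no new value left at `y`, the segment below `y` would map onto `X`, and a section would
  -- embed `X` into it.
  greedy-Seg : (W : WellOrder Y) → let open WellOrder W in X →
               (∀ y → ¬ (X ↣ Seg y)) → Y ↣ X
  greedy-Seg {X = X} W x₀ small = greedy W x₀ λ y g →
    dne λ all → small y (section (g ∘ proj₁) λ x →
      dne λ no-z → all (x , λ z z<y eq → no-z ((z , z<y) , eq)))
    where open WellOrder W

  abstract
    -- Either `X` embeds into a proper segment of `Y`, or a greedy enumeration along `Y` never
    -- exhausts `X`.
    compare : (X : Set a) (Y : Set b) → X ↣ Y ⊎ Y ↣ X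
    compare X Y with em X
    ... | no ¬x = inj₁ (mk↣ {to = λ x → contradiction x ¬x} λ {x} → contradiction x ¬x)
    ... | yes x₀ with em (∃ λ y → X ↣ WellOrder.Seg (wellOrder Y) y)
    ...   | yes (y , f) = inj₁ (WellOrder.Seg↣ (wellOrder Y) y ↣-∘ f)
    ...   | no none     = inj₂ (greedy-Seg (wellOrder Y) x₀ λ y f → none (y , f))

  abstract
    infinite⊎covered : (X : Set a) → ℕ ↣ X ⊎ ∃ (Covers {X = X})
    infinite⊎covered X with em (∃ (Covers {X = X}))
    ... | yes l = inj₂ l
    ... | no none = inj₁ (greedy ℕ-wellOrder
          (proj₁ (miss [])) λ n g →
            let x , x∉ = miss (map g (upTo n)) in
            x , λ m m<n eq → x∉ (subst (_∈ˡ map g (upTo n)) eq (∈-map⁺ g (∈-upTo⁺ m<n))))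
      where
      miss : (l : List X) → ∃ λ x → ¬ (x ∈ˡ l)
      miss l = ¬∀⇒∃¬ λ cov → none (l , cov)

  -- The order type is an initial ordinal, that is, a cardinal.
  Small : {X : Set a} → WellOrder X → Set a
  Small {X = X} W = ∀ x → ¬ (X ↣ WellOrder.Seg W x)

  abstract
    -- If some segment receives `X`, the order is pulled back from the least such segment; a segment
    -- of the new order embeds into a smaller one and cannot receive `X`.
    initialOrder : (X : Set a) → ∃ (Small {X = X})
    initialOrder X with em (Small (wellOrder X))
    ... | yes small = wellOrder X , small
    ... | no ¬small = pullback f W , λ y g → least-x (to f y) (proj₂ (to e y))
                        (Seg-pullback f W y ↣-∘ g)
      where
      W : WellOrder X
      W = wellOrder X
      open WellOrder W
      m : ∃ λ x → X ↣ Seg x × (∀ y → y < x → ¬ (X ↣ Seg y))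
      m = least W {P = λ x → X ↣ Seg x} (let x , p = ¬∀⇒∃¬ ¬small in x , dne p)
      e : X ↣ Seg (proj₁ m)
      e = proj₁ (proj₂ m)
      least-x : ∀ y → y < proj₁ m → ¬ (X ↣ Seg y)
      least-x = proj₂ (proj₂ m)
      f : X ↣ X
      f = Seg↣ _ ↣-∘ e

  -- Squares of infinite sets by Gödel's order of pairs, and lists.

  ↣-Maybe : ℕ ↣ X → (X × X) ↣ X → Maybe X ↣ X
  ↣-Maybe {X = X} ι sq = sq ↣-∘ mk↣ {to = f} λ {x} {y} → inj x y
    where
    f : Maybe X → X × X
    f nothing  = to ι 0 , to ι 1
    f (just x) = x , to ι 0

    1≢0 : to ι 1 ≢ to ι 0
    1≢0 eq with () ← injective ι eq

    inj : ∀ x y → f x ≡ f y → x ≡ y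
    inj nothing  nothing  _  = refl
    inj nothing  (just _) eq = contradiction (cong proj₂ eq) 1≢0
    inj (just _) nothing  eq = contradiction (sym (cong proj₂ eq)) 1≢0
    inj (just _) (just _) eq = cong (just ∘ proj₁) eq

  module Gödel {X : Set a} (W : WellOrder X) where
    open WellOrder W

    max : X → X → X
    max x y with em (x < y)
    ... | yes _ = y
    ... | no  _ = x

    x≤max : ∀ x y → ¬ (max x y < x)
    x≤max x y with em (x < y)
    ... | yes x<y = asym x<y
    ... | no  _   = irrefl

    y≤max : ∀ x y → ¬ (max x y < y)
    y≤max x y with em (x < y)
    ... | yes _   = irrefl
    ... | no  x≮y = x≮y

    -- Comparing maxima first confines the pairs below a given one to a square.
    key : X × X → X × (X × X)
    key (x , y) = max x y , (x , y)

    _⊏_ : Rel (X × (X × X)) a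
    _⊏_ = ×-Lex _≡_ _<_ (×-Lex _≡_ _<_ _<_)

    order : WellOrder (X × X)
    order = record
      { _<_        = λ p q → Holds (key p ⊏ key q)
      ; irrelevant = ≡-irrelevant
      ; total      = λ {p} {q} p≢q → Sum.map holds holds (cmp p q p≢q)
      ; wf         = Subrelation.wellFounded holds⁻¹
                       (On.wellFounded key (×-wellFounded wf (×-wellFounded wf wf)))
      }
      where
      cmp : ∀ p q → p ≢ q → key p ⊏ key q ⊎ key q ⊏ key p
      cmp p@(x , y) q@(u , v) p≢q with em (max x y ≡ max u v)
      ... | no ≢m = Sum.map inj₁ inj₁ (total ≢m)
      ... | yes ≡m with em (x ≡ u)
      ...   | no ≢x = Sum.map (λ r → inj₂ (≡m , inj₁ r)) (λ r → inj₂ (sym ≡m , inj₁ r)) (total ≢x)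
      ...   | yes refl = Sum.map (λ r → inj₂ (≡m , inj₂ (refl , r)))
                                 (λ r → inj₂ (sym ≡m , inj₂ (refl , r)))
                                 (total λ { refl → p≢q refl })

    bound : ∀ p q → key p ⊏ key q → ¬ (max (proj₁ q) (proj₂ q) < max (proj₁ p) (proj₂ p))
    bound p q (inj₁ m<n)     n<m = asym m<n n<m
    bound p q (inj₂ (m≡n , _)) n<m = irrefl (subst (_ <_) m≡n n<m)

    -- The elements up to and including `m` are coded by `Maybe (Seg m)`, with `nothing` in the
    -- place of `m`.
    toMaybe : ∀ m → X → Maybe (Seg m)
    toMaybe m x with em (x < m)
    ... | yes x<m = just (x , x<m)
    ... | no  _   = nothing

    toMaybe-injective : ∀ m {x y} → ¬ (m < x) → ¬ (m < y) →
                        toMaybe m x ≡ toMaybe m y → x ≡ y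
    toMaybe-injective m {x} {y} x≤m y≤m eq with em (x < m) | em (y < m)
    toMaybe-injective m x≤m y≤m refl | yes _ | yes _ = refl
    toMaybe-injective m x≤m y≤m eq | no x≮m | no y≮m =
      trans (≡m x≤m x≮m) (sym (≡m y≤m y≮m))
      where
      ≡m : ∀ {x} → ¬ (m < x) → ¬ (x < m) → x ≡ m
      ≡m p q = dne λ x≢m → [ q , p ]′ (total x≢m)

    Seg↣Maybe² : ∀ p → let m = max (proj₁ p) (proj₂ p) in
      WellOrder.Seg order p ↣ (Maybe (Seg m) × Maybe (Seg m))
    Seg↣Maybe² p = mk↣ {to = λ ((x , y) , _) → toMaybe m x , toMaybe m y}
      λ {((x , y) , r)} {((x′ , y′) , r′)} eq → WellOrder.Seg-≡ order (cong₂ _,_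
        (toMaybe-injective m (x≤ x y r) (x≤ x′ y′ r′) (cong proj₁ eq))
        (toMaybe-injective m (y≤ x y r) (y≤ x′ y′ r′) (cong proj₂ eq)))
      where
      m = max (proj₁ p) (proj₂ p)
      x≤ : ∀ x y → Holds (key (x , y) ⊏ key p) → ¬ (m < x)
      x≤ x y r m<x = bound (x , y) p (holds⁻¹ r) (<-≮-trans m<x (x≤max x y))
      y≤ : ∀ x y → Holds (key (x , y) ⊏ key p) → ¬ (m < y)
      y≤ x y r m<y = bound (x , y) p (holds⁻¹ r) (<-≮-trans m<y (y≤max x y))

  Covers-Maybe² : (l : List X) → Covers l →
                  Covers (cartesianProduct (nothing ∷ map just l) (nothing ∷ map just l))
  Covers-Maybe² l cov (x , y) = ∈-cartesianProduct⁺ (mem x) (mem y)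
    where
    mem : ∀ x → x ∈ˡ nothing ∷ map just l
    mem nothing  = here refl
    mem (just x) = there (∈-map⁺ just (cov x))

  -- If the greedy embedding failed, `X` would embed into the square of some `Maybe (Seg m)`. An
  -- infinite `Seg m` absorbs this square by hypothesis, against `Small`; a finite one makes `X`
  -- finite, against `ι`.
  square-step : (W : WellOrder X) → let open WellOrder W in Small W → ℕ ↣ X →
                (∀ x → ℕ ↣ Seg x → (Seg x × Seg x) ↣ Seg x) → (X × X) ↣ X
  square-step {X = X} W small ι sq = greedy-Seg order (to ι 0) λ p f →
    impossible (max (proj₁ p) (proj₂ p)) (Seg↣Maybe² p ↣-∘ f)
    where
    open WellOrder W
    open Gödel W using (order; max; Seg↣Maybe²)

    impossible : ∀ m → ¬ (X ↣ (Maybe (Seg m) × Maybe (Seg m)))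
    impossible m f with infinite⊎covered (Seg m)
    ... | inj₁ inf = small m (sq m inf ↣-∘ ((g ×↣ g) ↣-∘ f))
      where g = ↣-Maybe inf (sq m inf)
    ... | inj₂ (l , cov) = ℕ↣̸Fin (covers⇒↣Fin _ (Covers-Maybe² l cov) ↣-∘ (f ↣-∘ ι))

  -- Induction on `x`: either `Seg x` embeds into an earlier segment, and its square is absorbed
  -- there, or its own order is initial and `square-step` applies.
  square-Seg : (W : WellOrder X) → let open WellOrder W in
               ∀ x → ℕ ↣ Seg x → (Seg x × Seg x) ↣ Seg x
  square-Seg {X = X} W x = go (wf x)
    where
    open WellOrder W
    go : ∀ {x} → Acc _<_ x → ℕ ↣ Seg x → (Seg x × Seg x) ↣ Seg x
    go {x} (acc rs) ι with em (∃ λ y → y < x × Seg x ↣ Seg y)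
    ... | yes (y , y<x , f) = Seg-mono y<x ↣-∘ (go (rs y<x) (f ↣-∘ ι) ↣-∘ (f ×↣ f))
    ... | no none = square-step W′ (λ (y , y<x) f → none (y , y<x , Seg-pullback (Seg↣ x) W (y , y<x) ↣-∘ f)) ι
          λ (y , y<x) ι′ → let down = Seg-pullback (Seg↣ x) W (y , y<x); up = Seg-up y<x in
            up ↣-∘ (go (rs y<x) (down ↣-∘ ι′) ↣-∘ (down ×↣ down))
      where
      W′ = pullback (Seg↣ x) W
      Seg-up : ∀ {y} (y<x : y < x) → Seg y ↣ WellOrder.Seg W′ (y , y<x)
      Seg-up y<x = mk↣ {to = λ (z , z<y) → (z , <-trans z<y y<x) , z<y}
                       (Seg-≡ ∘ cong (proj₁ ∘ proj₁))

  abstract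
    square : ℕ ↣ X → (X × X) ↣ X
    square {X = X} ι = let W , small = initialOrder X in
      square-step W small ι (square-Seg W)

  List-map↣ : X ↣ Y → List X ↣ List Y
  List-map↣ f = mk↣ {to = map (to f)} (map-injective (injective f))

  abstract
    -- Iterated pairing is injective among lists of equal length, so the length is coded alongside.
    List↣ : ℕ ↣ X → List X ↣ X
    List↣ {X = X} ι = square ι ↣-∘ ((ι ×↣ square ι) ↣-∘ mk↣ {to = λ l → length l , code l} inj)
      where
      code : List X → X × X
      code []      = to ι 0 , to ι 0
      code (x ∷ l) = x , to (square ι) (code l)

      code-injective : ∀ l l′ → length l ≡ length l′ → code l ≡ code l′ → l ≡ l′
      code-injective []      []       _  _  = refl
      code-injective (x ∷ l) (y ∷ l′) p  eq = cong₂ _∷_ (cong proj₁ eq)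
        (code-injective l l′ (ℕ.suc-injective p) (injective (square ι) (cong proj₂ eq)))

      inj : ∀ {l l′} → (length l , code l) ≡ (length l′ , code l′) → l ≡ l′
      inj eq = code-injective _ _ (cong proj₁ eq) (cong proj₂ eq)

  -- Quotients of setoids.

  module Quotient (A : Setoid a b) where
    open Setoid A

    private
      -- As a map into propositional equality the choice is constant on each class, so it selects a
      -- system of representatives.
      normal : Σ (Func A (setoid Carrier)) λ f → ∀ x → x ≈ Func.to f x
      normal = ac A (setoid Carrier) _≈_
        (λ x≈y x≈z → Setoid.trans A (Setoid.sym A x≈y) x≈z)
        (λ { refl p → p })
        (λ x → x , Setoid.refl A)

    abstract
      Q : Set a
      Q = ∃ λ x → Func.to (proj₁ normal) x ≡ x

      [_] : Carrier → Q
      [ x ] = Func.to (proj₁ normal) x , Func.cong (proj₁ normal) (Setoid.sym A (proj₂ normal x))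

      rep : Q → Carrier
      rep = proj₁

      rep-[] : ∀ x → rep [ x ] ≈ x
      rep-[] x = Setoid.sym A (proj₂ normal x)

      private
        Q-≡ : ∀ {p q} → rep p ≡ rep q → p ≡ q
        Q-≡ {x , p} {.x , q} refl = cong (x ,_) (≡-irrelevant p q)

      []-cong : ∀ {x y} → x ≈ y → [ x ] ≡ [ y ]
      []-cong x≈y = Q-≡ (Func.cong (proj₁ normal) x≈y)

      []-rep : ∀ q → [ rep q ] ≡ q
      []-rep (x , p) = Q-≡ p

      []-injective : ∀ {x y} → [ x ] ≡ [ y ] → x ≈ y
      []-injective {x} {y} eq = Setoid.trans A (Setoid.sym A (rep-[] x))
        (Setoid.trans A (Setoid.reflexive A (cong rep eq)) (rep-[] y))

  -- The Cantor–Schröder–Bernstein theorem for a subset: move exactly the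
  -- points reached from outside of B by iterating f.
  module _ (A : Setoid a b) (B : Pred (Setoid.Carrier A) c) where
    private
      module A = Setoid A
      S = subsetoid A B

    subset-≋ : A ≼ S → S ≋ A
    subset-≋ f = Symmetry.bijection g⤖ λ {x} {y} x≈y → g-injective
      (A.trans (from-eq x) (A.trans x≈y (A.sym (from-eq y))))
      where
      module f = Injection f

      iter : ℕ → A.Carrier → A.Carrier
      iter zero    x = x
      iter (suc n) x = proj₁ (f.to (iter n x))

      -- `B` need not respect the equality, so being outside means being equal to no element of `B`.
      Moved : A.Carrier → Set _
      Moved x = ∃ λ n → ∃ λ y → ¬ (∃ λ z → B z × y A.≈ z) × x A.≈ iter n y

      Moved-resp : ∀ {x y} → x A.≈ y → Moved x → Moved y
      Moved-resp x≈y (n , z , out , p) = n , z , out , A.trans (A.sym x≈y) p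

      Moved-f : ∀ {x} → Moved x → Moved (proj₁ (f.to x))
      Moved-f (n , z , out , p) = suc n , z , out , f.cong p

      graph : ∀ x → Dec (Moved x) → ∃ λ (y : ∃ B) →
              (Moved x × y ≡ f.to x) ⊎ (¬ Moved x × x A.≈ proj₁ y)
      graph x (yes m) = f.to x , inj₁ (m , refl)
      graph x (no ¬m) =
        let z , z∈B , x≈z = dne λ out → ¬m (zero , x , out , A.refl)
        in (z , z∈B) , inj₂ (¬m , x≈z)

      g : A.Carrier → ∃ B
      g x = proj₁ (graph x (em _))

      g-cong : ∀ {x y} → x A.≈ y → proj₁ (g x) A.≈ proj₁ (g y)
      g-cong {x} {y} x≈y with graph x (em _) | graph y (em _)
      ... | _ , inj₁ (_ , refl) | _ , inj₁ (_ , refl) = f.cong x≈y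
      ... | _ , inj₁ (m , _)    | _ , inj₂ (¬m , _)   = contradiction (Moved-resp x≈y m) ¬m
      ... | _ , inj₂ (¬m , _)   | _ , inj₁ (m , _)    = contradiction (Moved-resp (A.sym x≈y) m) ¬m
      ... | _ , inj₂ (_ , p)    | _ , inj₂ (_ , q)    = A.trans (A.sym p) (A.trans x≈y q)

      g-injective : ∀ {x y} → proj₁ (g x) A.≈ proj₁ (g y) → x A.≈ y
      g-injective {x} {y} eq with graph x (em _) | graph y (em _)
      ... | _ , inj₁ (_ , refl) | _ , inj₁ (_ , refl) = f.injective eq
      ... | _ , inj₁ (m , refl) | _ , inj₂ (¬m , p) =
        contradiction (Moved-resp (A.trans eq (A.sym p)) (Moved-f m)) ¬m
      ... | _ , inj₂ (¬m , p)   | _ , inj₁ (m , refl) =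
        contradiction (Moved-resp (A.trans (A.sym eq) (A.sym p)) (Moved-f m)) ¬m
      ... | _ , inj₂ (_ , p)    | _ , inj₂ (_ , q)    = A.trans p (A.trans eq (A.sym q))

      g-surjective : ∀ y → ∃ λ x → proj₁ (g x) A.≈ proj₁ y
      g-surjective (y , y∈B) with em (Moved y)
      ... | yes (zero , z , out , p) = contradiction (y , y∈B , A.sym p) out
      ... | yes (suc n , z , out , p) = iter n z , lemma
        where
        lemma : proj₁ (g (iter n z)) A.≈ y
        lemma with graph (iter n z) (em _)
        ... | _ , inj₁ (_ , refl) = A.sym p
        ... | _ , inj₂ (¬m , _)   = contradiction (n , z , out , A.refl) ¬m
      ... | no ¬m = y , lemma
        where
        lemma : proj₁ (g y) A.≈ y
        lemma with graph y (em _)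
        ... | _ , inj₁ (m , _) = contradiction m ¬m
        ... | _ , inj₂ (_ , p) = A.sym p

      g⤖ : Bijection A S
      g⤖ = record
        { to        = g
        ; cong      = g-cong
        ; bijective = g-injective , λ y → proj₁ (g-surjective y) , λ z≈x →
            A.trans (g-cong z≈x) (proj₂ (g-surjective y))
        }

      from-eq : ∀ y → proj₁ (g (proj₁ (g-surjective y))) A.≈ proj₁ y
      from-eq y = A.trans (g-cong A.refl) (proj₂ (g-surjective y))

  -- Infinite predicates and small sets of lists.

  infinite-split : {P : Pred X p} (Q : Pred X b) → Infinite P →
                   Infinite (λ x → P x × Q x) ⊎ Infinite (λ x → P x × ¬ Q x)
  infinite-split {P = P} Q inf with em (Infinite (λ x → P x × Q x))
  ... | yes infQ = inj₁ infQ
  ... | no finQ = inj₂ λ l →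
    let m , none = ¬∀⇒∃¬ finQ
        x , px , x∉ = inf (m ++ l)
    in x , (px , λ qx → none (x , (px , qx) , x∉ ∘ ∈-++⁺ˡ)) , x∉ ∘ ∈-++⁺ʳ m

  infinite-remove : {P : Pred X p} (y : X) → Infinite P → Infinite (λ x → P x × x ≢ y)
  infinite-remove y inf l = let x , px , x∉ = inf (y ∷ l) in
    x , (px , x∉ ∘ here) , x∉ ∘ there

  List×List↣ : ℕ ↣ Z → X ↣ Z → Y ↣ Z → (List X × List Y) ↣ Z
  List×List↣ ι f g = square ι ↣-∘ ((List↣ ι ↣-∘ List-map↣ f) ×↣ (List↣ ι ↣-∘ List-map↣ g))

  -- The larger of `X` and `Y`, or `ℕ` if both are countable, absorbs all pairs of lists, so it
  -- would receive `Z`.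
  List×List-small : ¬ (Z ↣ X) → ¬ (Z ↣ Y) → ¬ (Z ↣ ℕ) → ¬ (Z ↣ (List X × List Y))
  List×List-small {X = X} {Y = Y} z≰x z≰y z≰ℕ f with compare X Y
  ... | inj₁ x≤y = case compare ℕ Y of λ
    { (inj₁ ι)   → z≰y (List×List↣ ι x≤y (↣-id Y) ↣-∘ f)
    ; (inj₂ y≤ℕ) → z≰ℕ (List×List↣ (↣-id ℕ) (y≤ℕ ↣-∘ x≤y) y≤ℕ ↣-∘ f) }
  ... | inj₂ y≤x = case compare ℕ X of λ
    { (inj₁ ι)   → z≰x (List×List↣ ι (↣-id X) y≤x ↣-∘ f)
    ; (inj₂ x≤ℕ) → z≰ℕ (List×List↣ (↣-id ℕ) x≤ℕ (x≤ℕ ↣-∘ y≤x) ↣-∘ f) }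

-- Spans.

module Span {ℓ : Level} {D : Ring ℓ ℓ} (M : LeftModule D ℓ ℓ) where
  open Ring D hiding (zero; refl; sym; trans)
  open LeftModule M
  open Basis D +ᴹ-commutativeMonoid _*ₗ_ using (combination)
  private
    module V = Setoid ≈ᴹ-setoid

  Span : List Carrierᴹ → Carrierᴹ → Set ℓ
  Span []       x = x ≈ᴹ 0ᴹ
  Span (v ∷ vs) x = ∃ λ d → ∃ λ y → x ≈ᴹ d *ₗ v +ᴹ y × Span vs y

  span-resp : ∀ vs {x y} → x ≈ᴹ y → Span vs x → Span vs y
  span-resp []       x≈y s = V.trans (V.sym x≈y) s
  span-resp (v ∷ vs) x≈y (d , z , p , s) = d , z , V.trans (V.sym x≈y) p , s

  span-weaken : ∀ v vs {x} → Span vs x → Span (v ∷ vs) x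
  span-weaken v vs {x} s =
    0# , x , V.sym (V.trans (+ᴹ-congʳ (*ₗ-zeroˡ v)) (+ᴹ-identityˡ x)) , s

  span-0 : ∀ vs → Span vs 0ᴹ
  span-0 []       = V.refl
  span-0 (v ∷ vs) = span-weaken v vs (span-0 vs)

  span-+ : ∀ vs {x y} → Span vs x → Span vs y → Span vs (x +ᴹ y)
  span-+ [] p q = V.trans (+ᴹ-cong p q) (+ᴹ-identityˡ 0ᴹ)
  span-+ (v ∷ vs) (d , x , p , s) (e , y , q , t) =
    d + e , x +ᴹ y ,
    V.trans (+ᴹ-cong p q)
      (V.trans (interchange +ᴹ-commutativeSemigroup _ _ _ _)
               (+ᴹ-congʳ (V.sym (*ₗ-distribʳ v d e)))) ,
    span-+ vs s t
    where open CommutativeMonoid +ᴹ-commutativeMonoid using ()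
            renaming (commutativeSemigroup to +ᴹ-commutativeSemigroup)

  span-* : ∀ vs c {x} → Span vs x → Span vs (c *ₗ x)
  span-* [] c p = V.trans (*ₗ-congˡ p) (*ₗ-zeroʳ c)
  span-* (v ∷ vs) c (d , x , p , s) =
    c * d , c *ₗ x ,
    V.trans (*ₗ-congˡ p) (V.trans (*ₗ-distribˡ c _ x) (+ᴹ-congʳ (V.sym (*ₗ-assoc c d v)))) ,
    span-* vs c s

  span-++ˡ : ∀ vs ws {x} → Span vs x → Span (vs ++ ws) x
  span-++ˡ []       ws p = span-resp ws (V.sym p) (span-0 ws)
  span-++ˡ (v ∷ vs) ws (d , y , p , s) = d , y , p , span-++ˡ vs ws s

  span-++ʳ : ∀ vs ws {x} → Span ws x → Span (vs ++ ws) x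
  span-++ʳ []       ws s = s
  span-++ʳ (v ∷ vs) ws s = span-weaken v (vs ++ ws) (span-++ʳ vs ws s)

  span-[-] : ∀ v → Span (v ∷ []) v
  span-[-] v = 1# , 0ᴹ , V.sym (V.trans (+ᴹ-identityʳ _) (*ₗ-identityˡ v)) , V.refl

  span-∈ : ∀ {v vs} → v ∈ˡ vs → Span vs v
  span-∈ {vs = v ∷ vs} (here refl) = span-++ˡ (v ∷ []) vs (span-[-] v)
  span-∈ {vs = _ ∷ vs} (there p) = span-weaken _ vs (span-∈ p)

  span-trans : ∀ vs ws {x} → All (Span ws) vs → Span vs x → Span ws x
  span-trans []       ws []       p               = span-resp ws (V.sym p) (span-0 ws)
  span-trans (v ∷ vs) ws (s ∷ ss) (d , y , p , t) =
    span-resp ws (V.sym p) (span-+ ws (span-* ws d s) (span-trans vs ws ss t))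

  SpanOf : ∀ {p} → Pred Carrierᴹ p → Pred Carrierᴹ (ℓ ⊔ p)
  SpanOf P x = ∃ λ vs → All P vs × Span vs x

  module _ {p} {P : Pred Carrierᴹ p} where

    spanOf-resp : ∀ {x y} → x ≈ᴹ y → SpanOf P x → SpanOf P y
    spanOf-resp x≈y (vs , ps , s) = vs , ps , span-resp vs x≈y s

    spanOf-0 : SpanOf P 0ᴹ
    spanOf-0 = [] , [] , V.refl

    spanOf-+ : ∀ {x y} → SpanOf P x → SpanOf P y → SpanOf P (x +ᴹ y)
    spanOf-+ (vs , ps , s) (ws , qs , t) =
      vs ++ ws , All.++⁺ ps qs , span-+ (vs ++ ws) (span-++ˡ vs ws s) (span-++ʳ vs ws t)

    spanOf-* : ∀ c {x} → SpanOf P x → SpanOf P (c *ₗ x)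
    spanOf-* c (vs , ps , s) = vs , ps , span-* vs c s

    spanOf-trans : ∀ vs {x} → All (SpanOf P) vs → Span vs x → SpanOf P x
    spanOf-trans []       []       p = spanOf-resp (V.sym p) spanOf-0
    spanOf-trans (v ∷ vs) (s ∷ ss) (d , y , p , t) =
      spanOf-resp (V.sym p) (spanOf-+ (spanOf-* d s) (spanOf-trans vs ss t))

    spanOf⇒combination : ∀ vs {x} → All P vs → Span vs x →
      Σ ℕ λ n → Σ (Vector Carrier n) λ d → Σ (Vector Carrierᴹ n) λ v →
      (∀ k → P (v k)) × x ≈ᴹ combination d v
    spanOf⇒combination [] [] p = 0 , (λ ()) , (λ ()) , (λ ()) , p
    spanOf⇒combination (v ∷ vs) (q ∷ qs) (d , y , p , s) =
      let n , ds , ws , qs′ , r = spanOf⇒combination vs qs s in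
      suc n , (d Vector.∷ ds) , (v Vector.∷ ws) ,
      (λ { zero → q ; (suc k) → qs′ k }) , V.trans p (+ᴹ-congˡ r)

  combination-span : ∀ {b} {B : Set b} (r : B → Carrierᴹ) {n} d (v : Vector Carrierᴹ n) (w : Fin n → B) →
                     (∀ k → r (w k) ≈ᴹ v k) → Span (map r (tabulate w)) (combination d v)
  combination-span r {zero}  d v w eq = V.refl
  combination-span r {suc n} d v w eq =
    d zero , _ , +ᴹ-congʳ (*ₗ-congˡ (V.sym (eq zero))) ,
    combination-span r (d ∘ suc) (v ∘ suc) (w ∘ suc) (eq ∘ suc)

-- Existence of bases.

module Bases (ac : AxiomOfChoice) {ℓ : Level} {D : Ring ℓ ℓ} (div : IsDivisionRing D)
             (M : LeftModule D ℓ ℓ) where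
  open Choice ac
  open Ring D hiding (zero; refl; sym; trans)
  open LeftModule M
  open LeftModuleProperties M using (inverseˡ-uniqueᴹ)
  open Basis D +ᴹ-commutativeMonoid _*ₗ_
  open Span M
  open MonoidSum +ᴹ-commutativeMonoid using (sum; sum-remove)
  private
    module V = Setoid ≈ᴹ-setoid
    module V̄ = Quotient ≈ᴹ-setoid
  open V̄ using ([_]; rep)

  private
    W : WellOrder V̄.Q
    W = wellOrder V̄.Q
    open WellOrder W

  -- Classes are ordered rather than vectors, so all representatives of a class are kept or none;
  -- independence concerns only families injective modulo the equality.
  greedyBasis : Pred Carrierᴹ ℓ
  greedyBasis v = ¬ SpanOf (λ w → [ w ] < [ v ]) v

  private
    spans : ∀ v → Acc _<_ [ v ] → SpanOf greedyBasis v
    spans v (acc rs) with em (greedyBasis v)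
    ... | yes v∈ = v ∷ [] , v∈ ∷ [] , span-[-] v
    ... | no  v∉ = let ws , below , s = dne v∉ in
      spanOf-trans ws (All.map (λ {w} w<v → spans w (rs w<v)) below) s

    maximum : ∀ {n} (P : Fin n → Set ℓ) (x : Fin n → V̄.Q) →
              (∀ k → ¬ P k) ⊎ ∃ λ k → P k × ∀ j → P j → ¬ (x k < x j)
    maximum {zero} P x = inj₁ λ ()
    maximum {suc n} P x with maximum (P ∘ suc) (x ∘ suc) | em (P zero)
    ... | inj₁ none | no ¬p = inj₁ λ { zero → ¬p ; (suc k) → none k }
    ... | inj₁ none | yes p = inj₂ (zero , p , λ
          { zero _ → irrefl ; (suc j) q → contradiction q (none j) })
    ... | inj₂ (k , q , max) | no ¬p = inj₂ (suc k , q , λ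
          { zero p → contradiction p ¬p ; (suc j) → max j })
    ... | inj₂ (k , q , max) | yes p with em (x (suc k) < x zero)
    ...   | no  k≮0 = inj₂ (suc k , q , λ { zero _ → k≮0 ; (suc j) → max j })
    ...   | yes k<0 = inj₂ (zero , p , λ
            { zero _ → irrefl ; (suc j) r 0<j → max j r (<-trans k<0 0<j) })

    spanOf-sum : ∀ {p} {P : Pred Carrierᴹ p} {n} (t : Vector Carrierᴹ n) →
                 (∀ k → SpanOf P (t k)) → SpanOf P (sum t)
    spanOf-sum {n = zero}  t s = spanOf-0
    spanOf-sum {n = suc n} t s = spanOf-+ (s zero) (spanOf-sum (t ∘ suc) (s ∘ suc))

    spanOf-neg : ∀ {p} {P : Pred Carrierᴹ p} {x y} → x +ᴹ y ≈ᴹ 0ᴹ →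
                 SpanOf P y → SpanOf P x
    spanOf-neg {x = x} {y} eq s = spanOf-resp
      (V.trans (inverseˡ-uniqueᴹ (- 1# *ₗ y) y neg) (V.sym (inverseˡ-uniqueᴹ x y eq)))
      (spanOf-* (- 1#) s)
      where
      neg : - 1# *ₗ y +ᴹ y ≈ᴹ 0ᴹ
      neg = V.trans (+ᴹ-congˡ (V.sym (*ₗ-identityˡ y)))
              (V.trans (V.sym (*ₗ-distribʳ y (- 1#) 1#))
                (V.trans (*ₗ-congʳ (-‿inverseˡ 1#)) (*ₗ-zeroˡ y)))

    -- The latest vector with a nonzero coefficient in a vanishing combination could be expressed
    -- through earlier ones, against its membership in `greedyBasis`.
    independent : LinearlyIndependent greedyBasis
    independent zero d v v∈ inj eq = λ ()
    independent (suc n) d v v∈ inj eq with maximum (λ k → ¬ (d k ≈ 0#)) ([_] ∘ v)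
    ... | inj₁ none = λ k → dne (none k)
    ... | inj₂ (k , dk≉0 , max) = λ _ → contradiction vk (v∈ k)
      where
      rest : ∀ j → SpanOf (λ w → [ w ] < [ v k ]) (removeAt (zipWith _*ₗ_ d v) k j)
      rest j with em (d (punchIn k j) ≈ 0#)
      ... | yes d≈0 = spanOf-resp (V.sym (V.trans (*ₗ-congʳ d≈0) (*ₗ-zeroˡ _))) spanOf-0
      ... | no  d≉0 = spanOf-* _ (_ , below ∷ [] , span-[-] _)
        where
        below : [ v (punchIn k j) ] < [ v k ]
        below = [ id , (λ gt → contradiction gt (max (punchIn k j) d≉0)) ]′
          (total λ eq → Fin.punchInᵢ≢i k j (inj (V̄.[]-injective eq)))

      dv : SpanOf (λ w → [ w ] < [ v k ]) (d k *ₗ v k)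
      dv = spanOf-neg (V.trans (V.sym (sum-remove (zipWith _*ₗ_ d v))) eq) (spanOf-sum _ rest)

      vk : SpanOf (λ w → [ w ] < [ v k ]) (v k)
      vk = let d⁻¹ , d⁻¹d≈1 , _ = IsDivisionRing.inverse div (d k) dk≉0 in
        spanOf-resp (V.trans (V.sym (*ₗ-assoc d⁻¹ (d k) (v k)))
                      (V.trans (*ₗ-congʳ d⁻¹d≈1) (*ₗ-identityˡ (v k))))
          (spanOf-* d⁻¹ dv)

  greedyBasis-isBasis : IsBasis greedyBasis
  greedyBasis-isBasis = independent , λ x →
    let vs , ps , s = spans x (wf [ x ]) in spanOf⇒combination vs ps s

-- Finitely generated parts of submodules.

module FiniteGeneration (ac : AxiomOfChoice) {ℓ : Level} {D : Ring ℓ ℓ} (div : IsDivisionRing D)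
                        (M : LeftModule D ℓ ℓ) where
  open LeftModule M
  open Choice ac
  open Ring D hiding (zero; refl; sym; trans)
  open RingProperties D using (-‿distribˡ-*)
  open Span M
  private
    module V = Setoid ≈ᴹ-setoid
    module D = Ring D

  -- The finitely generated submodule is the part of the span of vs in the image of E.
  finitelyGenerated : ∀ {g} {G : Set g} (E : G → Carrierᴹ) →
    (∀ d x y → ∃ λ z → E z ≈ᴹ E x +ᴹ d *ₗ E y) →
    ∀ vs → ∃ λ gs → ∀ x → Span vs (E x) → Span (map E gs) (E x)
  finitelyGenerated E closed [] = [] , λ x s → s
  finitelyGenerated E closed (v ∷ vs)
    with finitelyGenerated E closed vs
       | em (∃ λ x → ∃ λ d → ¬ (d ≈ 0#) × ∃ λ y → E x ≈ᴹ d *ₗ v +ᴹ y × Span vs y)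
  ... | gs , ih | no none = gs , λ x (d , y , p , s) → ih x
    (span-resp vs (V.sym (V.trans p (V.trans (+ᴹ-congʳ (V.trans
       (*ₗ-congʳ (dne λ d≉0 → none (x , d , d≉0 , y , p , s))) (*ₗ-zeroˡ v))) (+ᴹ-identityˡ y)))) s)
  -- The pivot `x₀` has a nonzero coefficient at `v`; adding a multiple of `E x₀` to `E x` clears
  -- that coefficient and leaves an element of the image in the span of `vs`.
  ... | gs , ih | yes (x₀ , d₀ , d₀≉0 , y₀ , p₀ , s₀) = x₀ ∷ gs , gen
    where
    d₀⁻¹ = proj₁ (IsDivisionRing.inverse div d₀ d₀≉0)

    gen : ∀ x → Span (v ∷ vs) (E x) → Span (map E (x₀ ∷ gs)) (E x)
    gen x s@(d , _) = span-resp (map E (x₀ ∷ gs)) restore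
      (span-+ (map E (x₀ ∷ gs)) (span-* (map E (x₀ ∷ gs)) (- t) (span-∈ {vs = map E (x₀ ∷ gs)} (here refl)))
        (span-weaken (E x₀) (map E gs) (ih z (span-resp vs (V.sym Ez≈u) s′))))
      where
      t = - (d * d₀⁻¹)
      z = proj₁ (closed t x x₀)

      sum-in-span : Span (v ∷ vs) (E x +ᴹ t *ₗ E x₀)
      sum-in-span = span-+ (v ∷ vs) s (span-* (v ∷ vs) t (d₀ , y₀ , p₀ , s₀))

      u = proj₁ (proj₂ sum-in-span)
      s′ : Span vs u
      s′ = proj₂ (proj₂ (proj₂ sum-in-span))

      coefficient : d + t * d₀ ≈ 0#
      coefficient = D.trans (+-congˡ (D.trans (D.sym (-‿distribˡ-* _ _))
        (-‿cong (D.trans (*-assoc d d₀⁻¹ d₀)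
          (D.trans (*-congˡ (proj₁ (proj₂ (IsDivisionRing.inverse div d₀ d₀≉0)))) (*-identityʳ d))))))
        (-‿inverseʳ d)

      Ez≈u : E z ≈ᴹ u
      Ez≈u = V.trans (proj₂ (closed t x x₀)) (V.trans (proj₁ (proj₂ (proj₂ sum-in-span)))
        (V.trans (+ᴹ-congʳ (V.trans (*ₗ-congʳ coefficient) (*ₗ-zeroˡ v))) (+ᴹ-identityˡ u)))

      restore : (- t) *ₗ E x₀ +ᴹ E z ≈ᴹ E x
      restore = V.trans (+ᴹ-congˡ (V.trans (proj₂ (closed t x x₀)) (+ᴹ-comm _ _)))
        (V.trans (V.sym (+ᴹ-assoc _ _ _)) (V.trans (+ᴹ-congʳ (V.trans (V.sym (*ₗ-distribʳ _ _ _))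
          (V.trans (*ₗ-congʳ (-‿inverseˡ t)) (*ₗ-zeroˡ _)))) (+ᴹ-identityˡ _)))

-- Left combinations of functions and right-linear relations between arguments.

module Functions {ℓ a : Level} (D : Ring ℓ ℓ) {Λ : Set a} where
  open Ring D hiding (zero; refl; sym; trans)
  open SetoidReasoning (Ring.setoid D)

  -- The longer list is truncated, so any list of scalars is an admissible list of coefficients.
  lin : List Carrier → List (Λ → Carrier) → Λ → Carrier
  lin (d ∷ ds) (c ∷ cs) x = d * c x + lin ds cs x
  lin _        _        x = 0#

  lin-cong : ∀ {ds es} → Pointwise _≈_ ds es → ∀ cs x → lin ds cs x ≈ lin es cs x
  lin-cong []       cs       x = Ring.refl D
  lin-cong (p ∷ ps) []       x = Ring.refl D
  lin-cong (p ∷ ps) (c ∷ cs) x = +-cong (*-congʳ p) (lin-cong ps cs x)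

  eval : (Λ → Carrier) → List (Λ × Carrier) → Carrier
  eval c []             = 0#
  eval c ((x , e) ∷ es) = c x * e + eval c es

  eval-cong : ∀ {c c′} es → All (λ (x , _) → c x ≈ c′ x) es → eval c es ≈ eval c′ es
  eval-cong []             []       = Ring.refl D
  eval-cong ((x , e) ∷ es) (p ∷ ps) = +-cong (*-congʳ p) (eval-cong es ps)

  eval-+ : ∀ d c c′ es → eval (λ x → d * c x + c′ x) es ≈ d * eval c es + eval c′ es
  eval-+ d c c′ [] = Ring.sym D (Ring.trans D (+-congʳ (zeroʳ d)) (+-identityˡ 0#))
  eval-+ d c c′ ((x , e) ∷ es) = begin
    (d * c x + c′ x) * e + eval (λ x → d * c x + c′ x) es
      ≈⟨ +-cong (distribʳ e _ _) (eval-+ d c c′ es) ⟩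
    ((d * c x) * e + c′ x * e) + (d * eval c es + eval c′ es)
      ≈⟨ interchange +-commutativeSemigroup _ _ _ _ ⟩
    ((d * c x) * e + d * eval c es) + (c′ x * e + eval c′ es)
      ≈⟨ +-congʳ (+-congʳ (*-assoc d (c x) e)) ⟩
    (d * (c x * e) + d * eval c es) + (c′ x * e + eval c′ es)
      ≈⟨ +-congʳ (distribˡ d _ _) ⟨
    d * (c x * e + eval c es) + (c′ x * e + eval c′ es) ∎

  eval-0 : ∀ es → eval (λ _ → 0#) es ≈ 0#
  eval-0 []             = Ring.refl D
  eval-0 ((x , e) ∷ es) = Ring.trans D (+-cong (zeroˡ e) (eval-0 es)) (+-identityˡ 0#)

  -- Scalars act on the left in `lin` and on the right in `eval`, so a right-linear relation shared
  -- by all of `cs` passes to their left combinations.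
  eval-lin : ∀ y es ds cs → All (λ c → c y ≈ eval c es) cs →
             lin ds cs y ≈ eval (lin ds cs) es
  eval-lin y es []       cs       ps       = Ring.sym D (eval-0 es)
  eval-lin y es (d ∷ ds) []       ps       = Ring.sym D (eval-0 es)
  eval-lin y es (d ∷ ds) (c ∷ cs) (p ∷ ps) = begin
    d * c y + lin ds cs y                   ≈⟨ +-cong (*-congˡ p) (eval-lin y es ds cs ps) ⟩
    d * eval c es + eval (lin ds cs) es     ≈⟨ eval-+ d c (lin ds cs) es ⟨
    eval (λ x → d * c x + lin ds cs x) es   ∎

-- Columns that depend on earlier columns.

module Dependence (ac : AxiomOfChoice) {ℓ a : Level} {D : Ring ℓ ℓ} (div : IsDivisionRing D)
                  {Λ : Set a} (W : WellOrder Λ) where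
  open Choice ac
  open WellOrder W
  open Ring D hiding (zero; refl; sym; trans)
  open RingProperties D using (-‿distribˡ-*; -‿distribʳ-*)
  open SetoidReasoning (Ring.setoid D)
  open Functions D {Λ}

  Dependent : ∀ {p} → Pred Λ p → List (Λ → Carrier) → Λ → Set _
  Dependent P cs y = P y × ∃ λ es →
    All (λ (x , _) → P x × x < y) es × All (λ c → c y ≈ eval c es) cs

  private
    -- Gaussian elimination
    eliminate : ∀ n cs → length cs ≡ n → ∀ {p} {P : Pred Λ p} → Infinite P → ∃ (Dependent P cs)
    eliminate zero [] _ inf = let y , py , _ = inf [] in y , py , [] , [] , []
    eliminate (suc n) (c ∷ cs) eq {P = P} inf with infinite-split (λ x → c x ≈ 0#) inf
    ... | inj₁ inf₀ with eliminate n cs (ℕ.suc-injective eq) inf₀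
    ...   | y , (py , cy≈0) , es , below , eqs =
      y , py , es , All.map (λ ((px , _) , x<y) → px , x<y) below ,
      Ring.trans D cy≈0 (Ring.sym D (Ring.trans D
        (eval-cong es (All.map (λ ((_ , cx≈0) , _) → cx≈0) below)) (eval-0 es))) ∷ eqs
    eliminate (suc n) (c ∷ cs) eq {P = P} inf | inj₂ inf₁
      -- The least argument at which `c` does not vanish is the pivot, so it precedes the remaining
      -- ones. Subtracting multiples of `c` makes the other functions vanish there.
      with least W {P = λ x → P x × ¬ (c x ≈ 0#)} (let x , px , _ = inf₁ [] in x , px)
    ... | z , (pz , cz≉0) , min
      with eliminate n (map (λ k x → - (k z * proj₁ (IsDivisionRing.inverse div (c z) cz≉0)) * c x + k x) cs)
                     (trans (length-map _ cs) (ℕ.suc-injective eq))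
                     (infinite-remove z inf₁)
    ... | y , (py , y≢z) , es , below , eqs =
      y , proj₁ py , (z , e) ∷ es ,
      ((pz , above py y≢z) ∷ All.map (λ (((px , _) , _) , x<y) → px , x<y) below) ,
      (eq₁ ∷ All.map (λ {k} → eqₖ k) (All.map⁻ eqs))
      where
      i = proj₁ (IsDivisionRing.inverse div (c z) cz≉0)
      -- The equation for `c` forces the coefficient of `z`: the term `c z * e` has to make up the
      -- defect `δ`.
      δ = c y + - eval c es
      e = i * δ

      above : ∀ {x} → P x × ¬ (c x ≈ 0#) → x ≢ z → z < x
      above px x≢z = [ (λ x<z → contradiction px (min _ x<z)) , id ]′ (total x≢z)

      c≈ : δ + eval c es ≈ c y
      c≈ = Ring.trans D (+-assoc _ _ _) (Ring.trans D (+-congˡ (-‿inverseˡ _)) (+-identityʳ _))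

      eq₁ : c y ≈ c z * e + eval c es
      eq₁ = begin
        c y                          ≈⟨ c≈ ⟨
        δ + eval c es                ≈⟨ +-congʳ (*-identityˡ δ) ⟨
        1# * δ + eval c es           ≈⟨ +-congʳ (*-congʳ (proj₂ (proj₂ (IsDivisionRing.inverse div (c z) cz≉0)))) ⟨
        (c z * i) * δ + eval c es    ≈⟨ +-congʳ (*-assoc (c z) i δ) ⟩
        c z * e + eval c es          ∎

      eqₖ : ∀ k → - (k z * i) * c y + k y ≈ eval (λ x → - (k z * i) * c x + k x) es →
            k y ≈ k z * e + eval k es
      eqₖ k p = begin
        k y                                       ≈⟨ +-identityˡ (k y) ⟨
        0# + k y                                  ≈⟨ +-congʳ (-‿inverseʳ (t * c y)) ⟨
        (t * c y + - (t * c y)) + k y             ≈⟨ +-assoc _ _ _ ⟩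
        t * c y + (- (t * c y) + k y)             ≈⟨ +-congˡ (+-congʳ (-‿distribˡ-* t (c y))) ⟩
        t * c y + (- t * c y + k y)               ≈⟨ +-congˡ p ⟩
        t * c y + eval (λ x → - t * c x + k x) es ≈⟨ +-congˡ (eval-+ (- t) c k es) ⟩
        t * c y + (- t * eval c es + eval k es)   ≈⟨ +-assoc _ _ _ ⟨
        (t * c y + - t * eval c es) + eval k es   ≈⟨ +-congʳ (+-congˡ (-‿distribˡ-* t (eval c es))) ⟨
        (t * c y + - (t * eval c es)) + eval k es ≈⟨ +-congʳ (+-congˡ (-‿distribʳ-* t (eval c es))) ⟩
        (t * c y + t * - eval c es) + eval k es   ≈⟨ +-congʳ (distribˡ t _ _) ⟨
        t * δ + eval k es                         ≈⟨ +-congʳ (*-assoc (k z) i δ) ⟩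
        k z * e + eval k es                       ∎
        where t = k z * i

  dependent : ∀ cs {p} {P : Pred Λ p} → Infinite P → ∃ (Dependent P cs)
  dependent cs = eliminate (length cs) cs refl

-- The lower bound card D ≤ card B.

module LowerBound (ac : AxiomOfChoice) {ℓ b : Level} {D : Ring ℓ ℓ} (div : IsDivisionRing D) where
  open Choice ac
  open Ring D hiding (zero; refl; sym; trans)
  open Quotient (Ring.setoid D)
  open Functions D {Q}

  AgreesInfinitely : (Q → Carrier) → List (Q → Carrier) → Set ℓ
  AgreesInfinitely g cs = ∃ λ ds → Infinite (λ x → g x ≈ lin ds cs x)

  module _ {B : Set b} (cs : List B → List (Q → Carrier))
    (agrees : (g : Q → Carrier) → Σ (List B) λ (bs : List B) → AgreesInfinitely g (cs bs))
    (agrees-covered : (bs : List B) → Covers bs → (g : Q → Carrier) → AgreesInfinitely g (cs bs))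
    where

    private
      ι : ℕ ↣ Q
      ι with infinite⊎covered Q
      ... | inj₁ ι = ι
      ... | inj₂ (l , cov) =
        let _ , _ , inf = agrees (λ _ → 0#)
            x , _ , x∉ = inf l
        in contradiction (cov x) x∉

      -- A diagonal argument: for a countable D the combinations of
      -- finitely many functions can be enumerated.
      module Countable (e : Q ↣ ℕ) (bs : List B) (cov : Covers bs) where

        code : List Q ↣ ℕ
        code = e ↣-∘ List↣ ι

        coded↣ : ∀ n → (∃ λ l → to code l ℕ.≤ n) ↣ Fin (suc n)
        coded↣ n = mk↣ {to = λ (l , p) → fromℕ< (s≤s p)} λ {(l , p)} {(l′ , p′)} eq →
          ≡-Σ p p′ (injective code (Fin.fromℕ<-injective _ _ (s≤s p) (s≤s p′) eq))
          where
          ≡-Σ : ∀ {l l′} (p : to code l ℕ.≤ n) (p′ : to code l′ ℕ.≤ n) →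
                l ≡ l′ → (l , p) ≡ (l′ , p′)
          ≡-Σ p p′ refl = cong (_ ,_) (ℕ.≤-irrelevant p p′)

        below↣ : ∀ n → (∃ λ x → to e x ℕ.< n) ↣ Fin n
        below↣ n = mk↣ {to = λ (x , p) → fromℕ< p} λ {(x , p)} {(x′ , p′)} eq →
          ≡-Σ p p′ (injective e (Fin.fromℕ<-injective _ _ p p′ eq))
          where
          ≡-Σ : ∀ {x x′} (p : to e x ℕ.< n) (p′ : to e x′ ℕ.< n) →
                x ≡ x′ → (x , p) ≡ (x′ , p′)
          ≡-Σ p p′ refl = cong (_ ,_) (ℕ.≤-irrelevant p p′)

        combination : List Q → Q → Carrier
        combination l = lin (map rep l) (cs bs)

        -- Only finitely many lists have a code up to that of `x`, and their combinations cannot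
        -- take all values in an infinite `Q`.
        avoid : ∀ x → ∃ λ y → ∀ l → to code l ℕ.≤ to e x → [ combination l x ] ≢ y
        avoid x = dne λ all → ℕ↣̸Fin (coded↣ (to e x) ↣-∘
          (section (λ (l , _) → [ combination l x ]) (λ y → dne λ no-l →
            all (y , λ l p eq → no-l ((l , p) , eq))) ↣-∘ ι))

        impossible : ⊥
        impossible with agrees-covered bs cov (rep ∘ proj₁ ∘ avoid)
        -- From the code of `ds` onwards the diagonal function differs from this combination, and
        -- only finitely many arguments come before that code.
        ... | ds , inf with infinite⊎covered (∃ λ x → to e x ℕ.< to code (map [_] ds))
        ...   | inj₁ κ = ℕ↣̸Fin (below↣ _ ↣-∘ κ)
        ...   | inj₂ (m , cov′) = let x , eq , x∉ = inf (map proj₁ m) in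
          [ (λ p → proj₂ (avoid x) (map [_] ds) p
                     (trans ([]-cong (Ring.trans D (lin-cong (rep-map ds) (cs bs) x) (Ring.sym D eq)))
                            ([]-rep _)))
          , (λ p → x∉ (∈-map⁺ proj₁ (cov′ (x , p)))) ]′ (ℕ.≤-<-connex (to code (map [_] ds)) (to e x))
          where
          rep-map : ∀ ds → Pointwise _≈_ (map rep (map [_] ds)) ds
          rep-map []       = []
          rep-map (d ∷ ds) = rep-[] d ∷ rep-map ds

      -- A value of g at y is forbidden when it is forced by a right-linear
      -- relation, chosen independently of g, between y and earlier arguments.
      module Uncountable (q≰ℕ : ¬ (Q ↣ ℕ)) (q≰b : ¬ (Q ↣ B)) where

        W = proj₁ (initialOrder Q)
        open WellOrder W
        open Dependence ac div W

        -- Coefficients stay out of the index to keep the indices few; one relation for each index,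
        -- picked by `em`, suffices.
        Index : Q → Set _
        Index y = List B × List (Seg y)

        Relation : ∀ y → Index y → Set _
        Relation y (bs , zs) = ∃ λ es →
          map proj₁ es ≡ map proj₁ zs × All (λ c → c y ≈ eval c es) (cs bs)

        value : (Q → Q) → ∀ y (i : Index y) → Dec (Relation y i) → Carrier
        value g y i (yes (es , _)) = eval (rep ∘ g) es
        value g y i (no _)         = 0#

        Ok : Q → (Q → Q) → Q → Set _
        Ok y g x = ∀ i → [ value g y i (em _) ] ≢ x

        transport : ∀ {p} (P : Pred Q p) {es : List (Q × Carrier)} {y} {zs : List (Seg y)} →
                    map proj₁ es ≡ map proj₁ zs → All (P ∘ proj₁) zs → All (P ∘ proj₁) es
        transport P eq ps = All.map⁻ (subst (All P) (sym eq) (All.map⁺ ps))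

        value-cong : ∀ {g g′} y i d → (∀ z → z < y → g z ≡ g′ z) → value g y i d ≈ value g′ y i d
        value-cong y (bs , zs) (no _)              eq = Ring.refl D
        value-cong y (bs , zs) (yes (es , p , _)) eq = eval-cong es
          (All.map (λ {(z , _)} z<y → Ring.reflexive D (cong rep (eq z z<y)))
            (transport (_< y) p (All.universal proj₂ zs)))

        -- Neither `B` nor `ℕ` nor, the order being initial, the segment below `y` receives `Q`.
        -- Hence the indices are too few to forbid every value.
        ok : ∀ y g → ∃ (Ok y g)
        ok y g = dne λ all → List×List-small q≰b (proj₂ (initialOrder Q) y) q≰ℕ
          (section (λ i → [ value g y i (em _) ]) λ x → dne λ no-i →
            all (x , λ i eq → no-i (i , eq)))

        independent = recursion W Ok
          (λ y {g} {g′} eq r i p → r i (trans ([]-cong (value-cong {g} {g′} y i (em _) eq)) p))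
          (to ι 0) ok

        g : Q → Q
        g = proj₁ independent

        impossible : ⊥
        impossible with agrees (rep ∘ g)
        ... | bs , ds , inf with dependent (cs bs) inf
        ...   | y , gy≈ , es , below , eqs =
          proj₂ independent y i (trans ([]-cong (forced (em _))) ([]-rep (g y)))
          where
          zs : List (Seg y)
          zs = All.reduce (λ {(z , _)} (_ , z<y) → z , z<y) below

          proj-zs : ∀ {es} (ps : All (λ (x , _) → rep (g x) ≈ lin ds (cs bs) x × x < y) es) →
                    map proj₁ es ≡ map proj₁ (All.reduce (λ {(z , _)} (_ , z<y) → z , z<y) ps)
          proj-zs []       = refl
          proj-zs (p ∷ ps) = cong (_ ∷_) (proj-zs ps)

          i : Index y
          i = bs , zs

          zs-eq : All (λ (x , _) → rep (g x) ≈ lin ds (cs bs) x) zs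
          zs-eq = All.map⁻ (subst (All _) (proj-zs below) (All.map⁺ (All.map proj₁ below)))

          forced : ∀ d → value g y i d ≈ rep (g y)
          forced (no none) = contradiction (es , proj-zs below , eqs) none
          -- The chosen relation may have other coefficients than `es`, but it has the same
          -- arguments, at which `rep ∘ g` agrees with the combination; so it forces the same value
          -- at `y`.
          forced (yes (es′ , p , eqs′)) = Ring.sym D (Ring.trans D gy≈
            (Ring.trans D (eval-lin y es′ ds (cs bs) eqs′) (Ring.sym D (eval-cong es′
              (transport (λ x → rep (g x) ≈ lin ds (cs bs) x) p zs-eq)))))

    -- If `Q` is countable and does not embed into `B`, then `B` is covered by one list and the
    -- diagonal argument applies; if `Q` is uncountable, the recursion does.
    lowerBound : Q ↣ B
    lowerBound = dne λ q≰b → case em (Q ↣ ℕ) of λ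
      { (no q≰ℕ) → Uncountable.impossible q≰ℕ q≰b
      ; (yes e)  → case infinite⊎covered B of λ
        { (inj₁ κ)        → q≰b (κ ↣-∘ e)
        ; (inj₂ (l , cov)) → Countable.impossible e l cov } }

-- Atoms modulo a filter, disjoint sequences and spread maps.

module FilterLemmas (ac : AxiomOfChoice) {ℓ : Level} {I : Set ℓ} {F : Collection I} (isFilter : IsFilter F) where
  open Choice ac
  open IsFilter isFilter

  -- The filter generated by `F` and `A`, with the implication from `A` to `S` written as a
  -- disjunction.
  adjoin : Pred I ℓ → Collection I
  adjoin A S = (λ i → S i ⊎ ¬ A i) ∈ F

  Positive : Pred I ℓ → Set ℓ
  Positive A = ¬ ((λ i → ¬ A i) ∈ F)

  -- An atom of the Boolean algebra of subsets modulo `F`.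
  Atom : Pred I ℓ → Set (lsuc ℓ)
  Atom A = Positive A × (∀ T → T ∈ adjoin A ⊎ (λ i → ¬ T i) ∈ adjoin A)

  adjoin-isFilter : ∀ A → IsFilter (adjoin A)
  adjoin-isFilter A = record
    { whole    = upward (λ _ → inj₁ tt) whole
    ; upward   = λ S⊆T → upward λ { (inj₁ s) → inj₁ (S⊆T s) ; (inj₂ ¬a) → inj₂ ¬a }
    ; ∩-closed = λ p q → upward
        (λ { (inj₁ s , inj₁ t) → inj₁ (s , t)
           ; (inj₂ ¬a , _) → inj₂ ¬a
           ; (_ , inj₂ ¬a) → inj₂ ¬a }) (∩-closed p q)
    }

  adjoin-isUltrafilter : ∀ {A} → Atom A → IsUltrafilter (adjoin A)
  adjoin-isUltrafilter {A} (pos , decides) = record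
    { isProperFilter = record
      { isFilter = adjoin-isFilter A
      ; proper   = λ all → pos (upward (λ { (inj₁ s) → ⊥-elim s ; (inj₂ ¬a) → ¬a }) (lowered (all (λ _ → Empty.⊥))))
      }
    ; maximal = λ G properG F⊆G {S} S∈G → case decides S of λ
      { (inj₁ S∈) → S∈
      ; (inj₂ ∁S∈) → let module G = IsFilter (IsProperFilter.isFilter properG) in
          contradiction (λ B → G.upward (λ (s , ¬s) → contradiction s ¬s) (G.∩-closed S∈G (F⊆G ∁S∈)))
            (IsProperFilter.proper properG)
      }
    }
    where
    lowered : (λ i → Empty.⊥ {ℓ} ⊎ ¬ A i) ∈ F → (λ i → ⊥ ⊎ ¬ A i) ∈ F
    lowered = upward λ { (inj₂ ¬a) → inj₂ ¬a }

  adjoin-isComplete : ∀ {κ} → IsComplete κ F → ∀ A → IsComplete κ (adjoin A)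
  adjoin-isComplete complete A J J≺κ S S∈ = upward
    (λ {i} s → case em (A i) of λ
      { (yes a) → inj₁ λ j → [ id , contradiction a ]′ (s j)
      ; (no ¬a) → inj₂ ¬a })
    (complete J J≺κ (λ j i → S j i ⊎ ¬ A i) S∈)

  -- P is a union of finitely many atoms modulo F.
  FinitelyAtomic : Pred I ℓ → Set (lsuc ℓ)
  FinitelyAtomic P = ∃ λ As → All Atom As × (∀ S → All (λ A → S ∈ adjoin A) As → S ∈ adjoin P)

  private
    join : ∀ P (T : Pred I ℓ) → FinitelyAtomic (P ∩ T) → FinitelyAtomic (λ i → P i × ¬ T i) → FinitelyAtomic P
    join P T (As , atoms , p) (Bs , atoms′ , q) = As ++ Bs , All.++⁺ atoms atoms′ , λ S all →
      upward (merge S) (∩-closed (p S (All.++⁻ˡ As all)) (q S (All.++⁻ʳ As all)))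
      where
      merge : ∀ S {i} → (S i ⊎ ¬ (P i × T i)) × (S i ⊎ ¬ (P i × ¬ T i)) → S i ⊎ ¬ P i
      merge S (inj₁ s , _) = inj₁ s
      merge S (_ , inj₁ s) = inj₁ s
      merge S (inj₂ f , inj₂ g) = inj₂ λ p → g (p , λ t → f (p , t))

    -- Such a `P` is positive and not an atom, so some `T` cuts it into two positive halves. By
    -- `join` one half is again not finitely atomic; it is kept and the other is removed.
    split : ∀ P → ¬ FinitelyAtomic P → ∃ λ P′ → ¬ FinitelyAtomic P′ × (∀ i → P′ i → P i) × Positive (λ i → P i × ¬ P′ i)
    split P ¬fa = case em (FinitelyAtomic (P ∩ T)) of λ
      { (no ¬fa′) → P ∩ T , ¬fa′ , (λ _ → proj₁) , λ ∁∈ → proj₁ T-splits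
          (upward (λ {i} h → case em (T i) of λ
            { (yes t) → inj₁ t ; (no ¬t) → inj₂ λ p → h (p , λ (_ , t) → ¬t t) }) ∁∈)
      ; (yes fa) → (λ i → P i × ¬ T i) , ¬fa ∘ join P T fa , (λ _ → proj₁) , λ ∁∈ → proj₂ T-splits
          (upward (λ {i} h → case em (T i) of λ
            { (yes t) → inj₂ λ p → h (p , λ (_ , ¬t) → ¬t t) ; (no ¬t) → inj₁ ¬t }) ∁∈) }
      where
      positive : Positive P
      positive ∁P∈ = ¬fa ([] , [] , λ _ _ → upward inj₂ ∁P∈)

      ¬atom : ¬ Atom P
      ¬atom atom = ¬fa (P ∷ [] , atom ∷ [] , λ { S (p ∷ []) → p })

      splitting = ¬∀⇒∃¬ λ decides → ¬atom (positive , decides)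
      T = proj₁ splitting
      T-splits : ¬ (T ∈ adjoin P) × ¬ ((λ i → ¬ T i) ∈ adjoin P)
      T-splits = proj₂ splitting ∘ inj₁ , proj₂ splitting ∘ inj₂

  -- Repeated splitting removes disjoint positive pieces, and `f` records the piece of a point. A
  -- member of `F` meets every piece, so `f` takes all values on it.
  disjointSequence : ∀ P → ¬ FinitelyAtomic P →
    ∃ λ (f : I → ℕ) → ∀ (R : Pred ℕ ℓ) → (R ∘ f) ∈ F → ∀ n → R n
  disjointSequence P ¬fa = f , λ R R∈ n → dne λ ¬r → proj₂ (proj₂ (proj₂ (next n)))
    (upward (λ {i} r a → ¬r (subst R (f-≡ n i a) r)) R∈)
    where
    seq : ℕ → ∃ λ P → ¬ FinitelyAtomic P
    next : ∀ n → ∃ λ P′ → ¬ FinitelyAtomic P′ × (∀ i → P′ i → proj₁ (seq n) i) ×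
                          Positive (λ i → proj₁ (seq n) i × ¬ P′ i)
    seq zero    = P , ¬fa
    seq (suc n) = let P′ , ¬fa′ , _ = next n in P′ , ¬fa′
    next n = split (proj₁ (seq n)) (proj₂ (seq n))

    Diff : ℕ → Pred I ℓ
    Diff n i = proj₁ (seq n) i × ¬ proj₁ (seq (suc n)) i

    decreasing : ∀ {m n} → m ℕ.≤′ n → proj₁ (seq n) ⊆ proj₁ (seq m)
    decreasing ℕ.≤′-refl p = p
    decreasing (ℕ.≤′-step {n} m≤n) p = decreasing m≤n (proj₁ (proj₂ (proj₂ (next n))) _ p)

    disjoint : ∀ {m n} → m ℕ.< n → ∀ {i} → Diff m i → ¬ Diff n i
    disjoint m<n (_ , out) (p , _) = out (decreasing (ℕ.≤⇒≤′ m<n) p)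

    unique : ∀ m n i → Diff m i → Diff n i → m ≡ n
    unique m n i p q with ℕ.<-cmp m n
    ... | tri< m<n _ _ = contradiction q (disjoint m<n p)
    ... | tri≈ _ eq _  = eq
    ... | tri> _ _ n<m = contradiction p (disjoint n<m q)

    f : I → ℕ
    f i with em (∃ λ n → Diff n i)
    ... | yes (n , _) = n
    -- The default is harmless: only the values on the pieces are used.
    ... | no  _       = 0

    f-≡ : ∀ n i → Diff n i → f i ≡ n
    f-≡ n i p with em (∃ λ n → Diff n i)
    ... | yes (m , q) = unique m n i q p
    ... | no none     = contradiction (n , p) none

  finiteIntersection : ∀ {κ} → IsComplete κ F → FinitelyAtomic (λ _ → ⊤) →
                       IsFiniteIntersectionOfCompleteUltrafilters κ F
  finiteIntersection complete (As , atoms , gen) =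
    length As , (λ k → adjoin (lookup As k)) ,
    (λ k → adjoin-isUltrafilter (All.lookup atoms (∈-lookup k)) , adjoin-isComplete complete _) ,
    (λ S∈ k → upward inj₁ S∈) ,
    λ {S} S∈ → upward (λ { (inj₁ s) → s ; (inj₂ ¬t) → contradiction tt ¬t })
      (gen S (All.tabulate λ A∈ → subst (λ A → S ∈ adjoin A) (sym (lookup-index A∈)) (S∈ (index A∈))))

  -- Phrases through predicates on `X` that every member of `F` has an infinite image.
  Spread : ∀ {a} {X : Set a} → (I → X) → Set _
  Spread {X = X} f = ∀ (P : Pred X ℓ) → (P ∘ f) ∈ F → Infinite P

  -- A point outside of the intersection goes to an index whose set it misses. If a list exhausted
  -- `P`, intersecting with the finitely many `A j` it names would leave only points of the
  -- intersection.
  incomplete⇒spread : {X J : Set ℓ} (h : J ↣ X) (A : J → Pred I ℓ) → (∀ j → A j ∈ F) →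
                      ¬ (⋂ J A ∈ F) → ∃ (Spread {X = X})
  incomplete⇒spread {J = J} h A A∈ ⋂∉ = to h ∘ miss , λ P P∈ l → dne λ none → ⋂∉
    (upward (λ {i} (p , t) → dne λ i∉ → miss-∉ i i∉
        (t (miss i) (dne λ ∉l → none (_ , p , ∉l))))
      (∩-closed P∈ (below l)))
    where
    -- An empty intersection would be the whole of `I`, so `J` has an element to serve as default.
    j₀ : J
    j₀ = dne λ ¬j → ⋂∉ (upward (λ _ j → contradiction j ¬j) whole)

    miss : I → J
    miss i with em (∃ λ j → ¬ A j i)
    ... | yes (j , _) = j
    ... | no  _       = j₀

    miss-∉ : ∀ i → ¬ (∀ j → A j i) → ¬ A (miss i) i
    miss-∉ i i∉ with em (∃ λ j → ¬ A j i)
    ... | yes (_ , p) = p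
    ... | no none     = contradiction (λ j → dne λ p → none (j , p)) i∉

    below : ∀ l → (λ i → ∀ j → to h j ∈ˡ l → A j i) ∈ F
    below [] = upward (λ _ _ ()) whole
    below (x ∷ l) with em (∃ λ j → to h j ≡ x)
    ... | no none = upward (λ { t j (here eq) → contradiction (j , eq) none ; t j (there p) → t j p }) (below l)
    ... | yes (j , eq) = upward
      (λ { {i} (a , t) j′ (here eq′) → subst (λ j → A j i) (injective h (trans eq (sym eq′))) a
         ; (a , t) j′ (there p) → t j′ p }) (∩-closed (A∈ j) (below l))

  sequence⇒spread : ∀ {a} {X : Set a} (ι : ℕ ↣ X) (f : I → ℕ) →
                    (∀ (R : Pred ℕ ℓ) → (R ∘ f) ∈ F → ∀ n → R n) → Spread (to ι ∘ f)
  sequence⇒spread ι f values P P∈ l = dne λ none →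
    ℕ↣̸Fin (⊆list⇒↣Fin ι l λ n → dne λ ∉l → none (to ι n , values (P ∘ to ι) P∈ n , ∉l))

-- The dimension of the reduced power.

module LeftDimension (ac : AxiomOfChoice) {ℓ : Level} (D : Ring ℓ ℓ) (div : IsDivisionRing D)
  (I : Set ℓ) (F : Collection I) (isFilter : IsFilter F) where
  open Choice ac
  open IsFilter isFilter
  open FilterLemmas ac isFilter
  open ReducedPower D I F isFilter
  open LeftModule leftModule
  open Basis D +ᴹ-commutativeMonoid _*ₗ_
  open Span leftModule
  open Ring D hiding (zero; refl; sym; trans; setoid)
  private
    module |D| = Quotient (Ring.setoid D)
    module |V| = Quotient carrierSetoid
    module V = Setoid carrierSetoid

  module _ (B : Pred Carrierᴹ ℓ) (spanning : Spanning B) where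
    private
      module |B| = Quotient (subsetoid carrierSetoid B)

      vec : |B|.Q → Carrierᴹ
      vec = proj₁ ∘ |B|.rep

      spans : ∀ x → ∃ λ bs → Span (map vec bs) x
      spans x = let n , d , v , v∈ , eq = spanning x
                    w = λ k → |B|.[ v k , v∈ k ] in
        tabulate w , span-resp (map vec (tabulate w)) (V.sym eq)
          (combination-span vec d v w λ k → |B|.rep-[] (v k , v∈ k))

    module _ {a} {X : Set a} (f : I → X) where
      open Functions D {X}
      open FiniteGeneration ac div leftModule

      generators : ∀ vs → ∃ λ gs → ∀ g → Span vs (g ∘ f) → Span (map (λ g → g ∘ f) gs) (g ∘ f)
      generators = finitelyGenerated {G = X → Carrier} (λ g → g ∘ f)
        (λ d g h → (λ x → g x + d * h x) , V.refl)

      -- These functions depend on `bs` alone and not on the function to be represented, as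
      -- `lowerBound` requires.
      coordinates : List |B|.Q → List (X → Carrier)
      coordinates bs = proj₁ (generators (map vec bs))

      span⇒lin : ∀ cs {v} → Span (map (λ g → g ∘ f) cs) v → ∃ λ ds → (λ i → v i ≈ lin ds cs (f i)) ∈ F
      span⇒lin []       p = [] , p
      span⇒lin (c ∷ cs) (d , y , p , s) = let ds , q = span⇒lin cs s in
        d ∷ ds , upward (λ (p , q) → Ring.trans D p (+-congˡ q)) (∩-closed p q)

      agrees : ∀ bs g → Span (map vec bs) (g ∘ f) →
               ∃ λ ds → (λ i → g (f i) ≈ lin ds (coordinates bs) (f i)) ∈ F
      agrees bs g s = span⇒lin (coordinates bs) (proj₂ (generators (map vec bs)) g s)

      covers⇒span : ∀ bs → Covers bs → ∀ x → Span (map vec bs) x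
      covers⇒span bs cov x = let bs′ , s = spans x in
        span-trans (map vec bs′) (map vec bs)
          (All.map⁺ (All.universal (λ b → span-∈ (∈-map⁺ vec (cov b))) bs′)) s

    spread⇒D≼B : (f : I → |D|.Q) → Spread f → |D|.Q ↣ |B|.Q
    spread⇒D≼B f spread = LowerBound.lowerBound ac div (coordinates f)
      (λ g → let bs , s = spans (g ∘ f)
                 ds , p = agrees f bs g s in bs , ds , spread _ p)
      (λ bs cov g → let ds , p = agrees f bs g (covers⇒span f bs cov _) in ds , spread _ p)

    -- If `B` were finite, finitely many functions on `ℕ` would generate all others. Elimination
    -- gives a `y` whose column depends on earlier ones, but the indicator of `y` vanishes at those
    -- and not at `y`.
    sequence⇒ℕ≼B : (f : I → ℕ) → (∀ (R : Pred ℕ ℓ) → (R ∘ f) ∈ F → ∀ n → R n) → ℕ ↣ |B|.Q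
    sequence⇒ℕ≼B f values with infinite⊎covered |B|.Q
    ... | inj₁ ι = ι
    ... | inj₂ (bs , cov) = contradiction 1≈0 (IsDivisionRing.1≉0 div)
      where
      open Functions D {ℕ}
      open Dependence ac div ℕ-wellOrder

      dep = dependent (coordinates f bs) {P = λ _ → ⊤ {0ℓ}} λ l → dne λ none →
              ℕ↣̸Fin (covers⇒↣Fin l λ n → dne λ ∉l → none (n , tt , ∉l))
      y  = proj₁ dep
      es = proj₁ (proj₂ (proj₂ dep))
      below = proj₁ (proj₂ (proj₂ (proj₂ dep)))
      eqs = proj₂ (proj₂ (proj₂ (proj₂ dep)))

      indicator : ℕ → Carrier
      indicator n with n ℕ.≟ y
      ... | yes _ = 1#
      ... | no  _ = 0#

      indicator-y : indicator y ≈ 1#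
      indicator-y with y ℕ.≟ y
      ... | yes _ = Ring.refl D
      ... | no ≢  = contradiction refl ≢

      indicator-< : ∀ {n} → n ℕ.< y → indicator n ≈ 0#
      indicator-< {n} n<y with n ℕ.≟ y
      ... | yes refl = contradiction n<y (ℕ.<-irrefl refl)
      ... | no _     = Ring.refl D

      sol = agrees f bs indicator (covers⇒span f bs cov _)
      ds = proj₁ sol
      indicator≈ : ∀ n → indicator n ≈ lin ds (coordinates f bs) n
      -- Agreement modulo `F` becomes agreement at every number, as `f` takes all values on members
      -- of `F`.
      indicator≈ = values _ (proj₂ sol)

      1≈0 : 1# ≈ 0#
      1≈0 = Ring.trans D (Ring.sym D indicator-y) (Ring.trans D (indicator≈ y)
        (Ring.trans D (eval-lin y es ds (coordinates f bs) eqs)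
          (Ring.trans D (eval-cong es (All.map
             (λ {(x , _)} (_ , x<y) → Ring.trans D (Ring.sym D (indicator≈ x)) (indicator-< x<y)) below))
            (eval-0 es))))

    V≼B : |D|.Q ↣ |B|.Q → ℕ ↣ |B|.Q → |V|.Q ↣ |B|.Q
    V≼B d≤b ι = List↣ ι ↣-∘ (List-map↣ (square ι ↣-∘ (d≤b ×↣ ↣-id _)) ↣-∘
      section (|V|.[_] ∘ value) λ q →
        let bs , s = spans (|V|.rep q)
            l , eq = code bs s
        in l , trans (|V|.[]-cong eq) (|V|.[]-rep q))
      where
      value : List (|D|.Q × |B|.Q) → Carrierᴹ
      value []            = 0ᴹ
      value ((d , b) ∷ l) = |D|.rep d *ₗ vec b +ᴹ value l

      code : ∀ bs {x} → Span (map vec bs) x → ∃ λ l → value l ≈ᴹ x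
      code []       p = [] , V.sym p
      code (b ∷ bs) (d , y , p , s) = let l , q = code bs s in
        (|D|.[ d ] , b) ∷ l , V.trans (+ᴹ-cong (*ₗ-congʳ (|D|.rep-[] d)) q) (V.sym p)

    spanning-≋ : |D|.Q ↣ |B|.Q → ℕ ↣ |B|.Q → subsetoid carrierSetoid B ≋ carrierSetoid
    spanning-≋ d≤b ι = subset-≋ carrierSetoid B record
      { to        = |B|.rep ∘ to f ∘ |V|.[_]
      ; cong      = λ p → Setoid.reflexive (subsetoid carrierSetoid B) (cong (|B|.rep ∘ to f) (|V|.[]-cong p))
      ; injective = λ {x} {y} p → |V|.[]-injective (injective f
          (trans (sym (|B|.[]-rep _)) (trans (|B|.[]-cong p) (|B|.[]-rep _))))
      }
      where f = V≼B d≤b ι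

  -- Otherwise comparability makes D strictly smaller than `J`, and its successor `κ` would embed
  -- into `J`.
  smaller-↣ : {κ : Setoid ℓ ℓ} → IsSuccessorCardinal κ (Ring.setoid D) →
              (J : Set ℓ) → setoid J ≺ κ → J ↣ |D|.Q
  smaller-↣ (_ , min) J (_ , κ⋠J) with compare J |D|.Q
  ... | inj₁ f = f
  ... | inj₂ g = dne λ J⋠D → κ⋠J (min (setoid J)
    ( record { to = to g ∘ |D|.[_] ; cong = cong (to g) ∘ |D|.[]-cong
             ; injective = |D|.[]-injective ∘ injective g }
    , λ h → J⋠D (mk↣ {to = |D|.[_] ∘ to h} (injective h ∘ |D|.[]-injective))))

  hasLeftDimension : (κ : Setoid ℓ ℓ) → IsSuccessorCardinal κ (Ring.setoid D) →
    ¬ IsFiniteIntersectionOfCompleteUltrafilters κ F →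
    HasLeftDimension leftModule carrierSetoid
  hasLeftDimension κ succ ¬fin =
    (greedyBasis , greedyBasis-isBasis) , λ B (_ , spanning) →
      let d≤b , ι = large B spanning in spanning-≋ B spanning d≤b ι
    where
    open Bases ac div leftModule

    -- A spread map into D yields both embeddings, so without them `F` is complete. A disjoint
    -- sequence gives a spread map if D is infinite, and `ℕ ↣ |B|.Q` directly if D is finite; so `F`
    -- is also finitely atomic, against `¬fin`.
    large : ∀ B (spanning : Spanning B) → let module |B| = Quotient (subsetoid carrierSetoid B) in
            |D|.Q ↣ |B|.Q × ℕ ↣ |B|.Q
    large B spanning = dne λ ¬large →
      let module |B| = Quotient (subsetoid carrierSetoid B)

          not-spread : (f : I → |D|.Q) → ¬ Spread f
          not-spread f spread = let d≤b = spread⇒D≼B B spanning f spread in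
            case infinite⊎covered |D|.Q of λ
              { (inj₁ ι) → ¬large (d≤b , d≤b ↣-∘ ι)
              ; (inj₂ (l , cov)) → let x , _ , x∉ = spread (λ _ → ⊤) whole l in x∉ (cov x) }

          complete : IsComplete κ F
          complete J J≺κ A A∈ = dne λ ⋂∉ →
            let f , spread = incomplete⇒spread (smaller-↣ succ J J≺κ) A A∈ ⋂∉ in
            not-spread f spread

          atomic : FinitelyAtomic (λ _ → ⊤)
          atomic = dne λ ¬fa →
            let f , values = disjointSequence _ ¬fa
                ι = sequence⇒ℕ≼B B spanning f values in
            case infinite⊎covered |D|.Q of λ
              { (inj₁ κ) → not-spread (to κ ∘ f) (sequence⇒spread κ f values)
              ; (inj₂ (l , cov)) → ¬large
                  (ι ↣-∘ (mk↣ {to = toℕ} (Fin.toℕ-injective) ↣-∘ covers⇒↣Fin l cov) , ι) }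
      in ¬fin (finiteIntersection complete atomic)

-- Passage to the opposite ring.

op-isDivisionRing : ∀ {ℓ} {D : Ring ℓ ℓ} → IsDivisionRing D → IsDivisionRing (Op.ring D)
op-isDivisionRing div = record
  { 1≉0     = 1≉0
  ; inverse = λ x x≉0 → let x⁻¹ , p , q = inverse x x≉0 in x⁻¹ , q , p
  }
  where open IsDivisionRing div

corollary13 :
    AxiomOfChoice →
    ∀ {ℓ} (D : Ring ℓ ℓ) → IsDivisionRing D →
    (I : Set ℓ) (F : Collection I) (isFilter : IsFilter F) →
    (κ : Setoid ℓ ℓ) → IsSuccessorCardinal κ (Ring.setoid D) →
    ¬ IsFiniteIntersectionOfCompleteUltrafilters κ F →
    let open ReducedPower D I F isFilter in
    HasLeftDimension leftModule carrierSetoid × HasRightDimension rightModule carrierSetoid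
corollary13 ac D div I F isFilter κ succ ¬fin =
  LeftDimension.hasLeftDimension ac D div I F isFilter κ succ ¬fin ,
  -- Left scalars from the opposite ring multiply on the right in D, while the relation modulo `F`
  -- is unchanged.
  LeftDimension.hasLeftDimension ac (Op.ring D) (op-isDivisionRing div) I F isFilter κ succ ¬fin
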